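{- As $n\to\infty$, one has $\omega(1)=\chi_{\mu}(Q_{n})=O(\log\log n)$. That is: (i) for every positive integer $q$ there exists $n_0$ such that $\chi_{\mu}(Q_n)>q$ for all integers $n\ge n_0$; and (ii) there exist constants $C>0$ and $n_1$ such that $\chi_{\mu}(Q_n)\le C\log\log n$ for all integers $n\ge n_1$.
   Context: For $n\in\mathbb{N}$, write $[n]=\{1,\dots,n\}$. The $n$-dimensional hypercube $Q_n$ is the graph with vertex set $2^{[n]}$ (all subsets of $[n]$), in which two vertices $A,B\in 2^{[n]}$ are adjacent if and only if their symmetric difference $A\Delta B=(A\setminus B)\cup(B\setminus A)$ has size $1$. For a simple graph $G$, a subset $M\subseteq V(G)$ is a mutual-visibility set in $G$ if for any two vertices $u,v\in M$ there exists a shortest $u$-$v$ path in $G$ that contains no elements of $M$ as internal vertices. The number $\chi_{\mu}(G)$ is the least number of colors needed to color the vertices of $G$ so that each color class is a mutual-visibility set in $G$; equivalently, it is the smallest integer such that $V(G)$ can be partitioned into $\chi_{\mu}(G)$ mutual-visibility sets. Logarithms are in base $2$. -}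

module Defs where

open import Data.Bool.Base using (true; false)
import Data.Bool.Properties as Bool
open import Data.Fin.Base using (Fin; zero; suc)
import Data.Fin.Properties as Fin
open import Data.Fin.Subset using (Subset; _∪_; _─_; ∣_∣)
open import Data.Fin.Subset.Properties using (∪-comm)
import Data.Integer.Base as ℤ
open import Data.List.Base
  using (List; []; _∷_; length; head; last; lookup; cartesianProductWith)
open import Data.List.Membership.Propositional using (_∈_; find; lose)
open import Data.List.Membership.Propositional.Properties
  using (∈-cartesianProductWith⁺; ∈-lookup)
import Data.List.Membership.Setoid.Properties as Membershipₛ
open import Data.List.Relation.Unary.All as All using (All)
open import Data.List.Relation.Unary.AllPairs using ([]; _∷_; allPairs?)
open import Data.List.Relation.Unary.Any using (here; there; index; any?)
open import Data.List.Relation.Unary.Any.Properties using (lookup-index)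
open import Data.List.Relation.Unary.Linked using (Linked; [-]; linked?)
open import Data.List.Relation.Unary.Unique.Propositional using (Unique)
open import Data.Maybe.Base using (just)
import Data.Maybe.Properties as Maybe
open import Data.Nat.Base using (ℕ; zero; suc; _+_; _*_; _^_; _≤_; _<_; z≤n; s≤s)
import Data.Nat.Properties as ℕ
open import Data.Nat.Properties
  using (<-≤-trans; ≮⇒≥; <⇒≱; ≤-reflexive; +-suc; +-identityʳ; m<1+n⇒m<n∨m≡n)
open import Data.Product.Base using (∃; ∃-syntax; _×_; _,_; proj₁; proj₂)
open import Data.Rational.Base using (ℚ; ↥_; ↧ₙ_)
open import Data.Sum.Base using (_⊎_; inj₁; inj₂)
open import Data.Vec.Base using ([]; _∷_)
open import Data.Vec.Functional using () renaming (_∷_ to _∷ᶠ_)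
import Data.Vec.Properties as Vec
open import Function.Base using (_∘_)
open import Level using (0ℓ)
open import Relation.Binary.Core using (Rel)
import Relation.Binary.Definitions as B
open import Relation.Binary.PropositionalEquality
  using (_≡_; _≢_; _≗_; refl; sym; trans; cong; subst; setoid)
open import Relation.Nullary.Decidable
  using (Dec; yes; no; map′; ¬?; _×-dec_; _⊎-dec_; _→-dec_)
open import Relation.Nullary.Negation.Core using (¬_; contradiction)
open import Relation.Unary using (Pred; Decidable)

-- The last four fields express finiteness constructively; `vertices` may
-- contain repetitions.
record FiniteSimpleGraph : Set₁ where
  infix 4 _∼_ _≟_ _∼?_
  field
    V          : Set
    _∼_        : Rel V 0ℓ
    ∼-sym      : ∀ {u v} → u ∼ v → v ∼ u
    ∼-irrefl   : ∀ {v} → ¬ (v ∼ v)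
    _≟_        : B.DecidableEquality V
    _∼?_       : B.Decidable _∼_
    vertices   : List V
    ∈-vertices : ∀ v → v ∈ vertices

IsLeast : Pred ℕ 0ℓ → Pred ℕ 0ℓ
IsLeast P k = P k × (∀ m → P m → k ≤ m)

module _ (G : FiniteSimpleGraph) where
  open FiniteSimpleGraph G

  -- A path is given by the list of all its vertices, endpoints included.
  record IsPath (u v : V) (xs : List V) : Set where
    constructor isPath
    field
      starts   : head xs ≡ just u
      ends     : last xs ≡ just v
      linked   : Linked _∼_ xs
      distinct : Unique xs

  -- A path has one vertex more than it has edges, so comparing numbers of
  -- vertices is the same as comparing lengths.
  IsShortestPath : V → V → List V → Set
  IsShortestPath u v xs =
    IsPath u v xs × (∀ ys → IsPath u v ys → length xs ≤ length ys)

  IsMutualVisibilitySet : Pred V 0ℓ → Set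
  IsMutualVisibilitySet M = ∀ u v → M u → M v →
    ∃[ xs ] IsShortestPath u v xs
          × (∀ x → x ∈ xs → x ≢ u → x ≢ v → ¬ M x)

  -- Unused colours are harmless, since the empty set is a mutual-visibility set.
  IsMutualVisibilityColouring : ∀ {k} → (V → Fin k) → Set
  IsMutualVisibilityColouring c = ∀ i → IsMutualVisibilitySet (λ v → c v ≡ i)

  MutualVisibilityColourable : ℕ → Set
  MutualVisibilityColourable k = ∃[ c ] IsMutualVisibilityColouring {k} c

-- The least number of colours exists constructively because colourability of a
-- finite graph is decidable and assigning distinct colours to distinct vertices
-- is always allowed.
private
  least : ∀ {P : Pred ℕ 0ℓ} → Decidable P → ∃ P → ∃ (IsLeast P)
  least {P} P? (k , Pk) =
    go k 0 (λ _ ()) (≤-reflexive (sym (+-identityʳ k)))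
    where
    go : ∀ d b → (∀ m → m < b → ¬ P m) → k ≤ d + b → ∃ (IsLeast P)
    go d b below k≤d+b with P? b
    ... | yes Pb = b , Pb , λ m Pm → ≮⇒≥ λ m<b → below m m<b Pm
    go zero b below k≤b | no ¬Pb =
      k , Pk , λ m Pm → ≮⇒≥ λ m<k → below m (<-≤-trans m<k k≤b) Pm
    go (suc d) b below k≤ | no ¬Pb =
      go d (suc b) below′ (subst (k ≤_) (sym (+-suc d b)) k≤)
      where
      below′ : ∀ m → m < suc b → ¬ P m
      below′ m m<1+b Pm with m<1+n⇒m<n∨m≡n m<1+b
      ... | inj₁ m<b  = below m m<b Pm
      ... | inj₂ refl = ¬Pb Pm

  anyFunction? : ∀ {k} n {P : Pred (Fin n → Fin k) 0ℓ} →
                 (∀ {f g} → f ≗ g → P f → P g) → Decidable P → Dec (∃ P)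
  anyFunction? zero resp P? =
    map′ (empty ,_) (λ (f , p) → resp {f} {empty} (λ ()) p) (P? empty)
    where
    empty : Fin 0 → Fin _
    empty ()
  anyFunction? (suc n) {P} resp P? =
    map′ (λ (a , f , p) → (a ∷ᶠ f) , p)
         (λ (f , p) → f zero , f ∘ suc ,
                      resp (λ { zero → refl ; (suc _) → refl }) p)
         (Fin.any? λ a → anyFunction? n {λ f → P (a ∷ᶠ f)}
           (λ f≗g → resp λ { zero → refl ; (suc i) → f≗g i })
           (λ f → P? (a ∷ᶠ f)))

  lookup-injective : ∀ {A : Set} {xs : List A} → Unique xs →
                     ∀ {i j} → lookup xs i ≡ lookup xs j → i ≡ j
  lookup-injective (_ ∷ _) {zero}  {zero}  _  = refl
  lookup-injective (p ∷ _) {zero}  {suc j} eq =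
    contradiction eq (All.lookup p (∈-lookup j))
  lookup-injective (p ∷ _) {suc i} {zero}  eq =
    contradiction (sym eq) (All.lookup p (∈-lookup i))
  lookup-injective (_ ∷ u) {suc i} {suc j} eq = cong suc (lookup-injective u eq)

  module Decide (G : FiniteSimpleGraph) where
    open FiniteSimpleGraph G

    any∈V? : {P : Pred V 0ℓ} → Decidable P → Dec (∃ P)
    any∈V? P? = map′ (λ a → let x , _ , p = find a in x , p)
                     (λ (x , p) → lose (∈-vertices x) p)
                     (any? P? vertices)

    all∈V? : {P : Pred V 0ℓ} → Decidable P → Dec (∀ x → P x)
    all∈V? P? = map′ (λ ps x → All.lookup ps (∈-vertices x))
                     (λ p → All.tabulate λ {x} _ → p x)
                     (All.all? P? vertices)

    anyShortList? : ∀ b {P : Pred (List V) 0ℓ} → Decidable P →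
                    Dec (∃[ xs ] length xs < b × P xs)
    anyShortList? zero P? = no λ { (_ , () , _) }
    anyShortList? (suc b) {P} P? =
      map′ to from (P? [] ⊎-dec any∈V? λ x → anyShortList? b (P? ∘ (x ∷_)))
      where
      Split = P [] ⊎ ∃[ x ] ∃[ xs ] length xs < b × P (x ∷ xs)
      to : Split → ∃[ xs ] length xs < suc b × P xs
      to (inj₁ p)                = [] , s≤s z≤n , p
      to (inj₂ (x , xs , l , p)) = x ∷ xs , s≤s l , p
      from : ∃[ xs ] length xs < suc b × P xs → Split
      from ([]     , _     , p) = inj₁ p
      from (x ∷ xs , s≤s l , p) = inj₂ (x , xs , l , p)

    unique⇒short : ∀ {xs} → Unique xs → length xs ≤ length vertices
    unique⇒short {xs} u = Fin.injective⇒≤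
      {f = λ i → index (∈-vertices (lookup xs i))}
      (λ eq → lookup-injective u
        (Membershipₛ.index-injective (setoid V) (∈-vertices _) (∈-vertices _) eq))

    isPath? : ∀ u v → Decidable (IsPath G u v)
    isPath? u v xs =
      map′ (λ (a , b , c , d) → isPath a b c d)
           (λ (isPath a b c d) → a , b , c , d)
           (Maybe.≡-dec _≟_ (head xs) (just u) ×-dec
            Maybe.≡-dec _≟_ (last xs) (just v) ×-dec
            linked? _∼?_ xs ×-dec
            allPairs? (λ x y → ¬? (x ≟ y)) xs)

    isShortestPath? : ∀ u v → Decidable (IsShortestPath G u v)
    isShortestPath? u v xs = isPath? u v xs ×-dec
      map′ (λ none ys p → ≮⇒≥ λ l → none (ys , l , p))
           (λ all (ys , l , p) → <⇒≱ l (all ys p))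
           (¬? (anyShortList? (length xs) (isPath? u v)))

    isMutualVisibilitySet? : ∀ {M} → Decidable M → Dec (IsMutualVisibilitySet G M)
    isMutualVisibilitySet? {M} M? =
      all∈V? λ u → all∈V? λ v → M? u →-dec M? v →-dec
        map′ (λ (xs , _ , p) → xs , p)
             (λ (xs , p) → xs ,
                s≤s (unique⇒short (IsPath.distinct (proj₁ (proj₁ p)))) , p)
             (anyShortList? (suc (length vertices)) λ xs →
               isShortestPath? u v xs ×-dec
               map′ (λ ps x x∈ → All.lookup ps x∈) (λ p → All.tabulate λ {x} → p x)
                 (All.all? (λ x →
                   ¬? (x ≟ u) →-dec ¬? (x ≟ v) →-dec ¬? (M? x)) xs))

    isColouring? : ∀ {k} → Decidable (IsMutualVisibilityColouring G {k})
    isColouring? c = Fin.all? λ i → isMutualVisibilitySet? λ v → c v Fin.≟ i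

    isColouring-resp : ∀ {k} {c d : V → Fin k} → c ≗ d →
      IsMutualVisibilityColouring G c → IsMutualVisibilityColouring G d
    isColouring-resp c≗d C i u v du dv =
      let xs , s , free = C i u v (trans (c≗d u) du) (trans (c≗d v) dv)
      in xs , s , λ x x∈ x≢u x≢v dx → free x x∈ x≢u x≢v (trans (c≗d x) dx)

    number : V → Fin (length vertices)
    number v = index (∈-vertices v)

    colourable? : Decidable (MutualVisibilityColourable G)
    colourable? k =
      map′ (λ (f , C) → f ∘ number , C)
           (λ (c , C) → c ∘ lookup vertices ,
              isColouring-resp (λ v → cong c (lookup-index (∈-vertices v))) C)
           (anyFunction? (length vertices)
             (λ f≗g → isColouring-resp (f≗g ∘ number))
             (λ f → isColouring? (f ∘ number)))

    colourable : MutualVisibilityColourable G (length vertices)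
    colourable = number , λ i u v nu nv →
      trivial {λ w → number w ≡ i} (Membershipₛ.index-injective (setoid V) (∈-vertices u) (∈-vertices v)
                (trans nu (sym nv)))
      where
      trivial : ∀ {M : Pred V 0ℓ} {u v} → u ≡ v →
        ∃[ xs ] IsShortestPath G u v xs × (∀ x → x ∈ xs → x ≢ u → x ≢ v → ¬ M x)
      trivial {u = u} refl =
        u ∷ [] ,
        (isPath refl refl [-] (All.[] ∷ []) ,
         λ { [] (isPath () _ _ _) ; (_ ∷ _) _ → s≤s z≤n }) ,
        λ { _ (here x≡u) x≢u _ _ → x≢u x≡u }

abstract
  χμ-exists : ∀ G → ∃ (IsLeast (MutualVisibilityColourable G))
  χμ-exists G = least (Decide.colourable? G) (_ , Decide.colourable G)

χμ : FiniteSimpleGraph → ℕ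
χμ G = proj₁ (χμ-exists G)

χμ-isLeast : ∀ G → IsLeast (MutualVisibilityColourable G) (χμ G)
χμ-isLeast G = proj₂ (χμ-exists G)

infixl 6 _△_
_△_ : ∀ {n} → Subset n → Subset n → Subset n
A △ B = (A ─ B) ∪ (B ─ A)

private
  ∣A△A∣≡0 : ∀ {n} (A : Subset n) → ∣ A △ A ∣ ≡ 0
  ∣A△A∣≡0 []          = refl
  ∣A△A∣≡0 (true  ∷ A) = ∣A△A∣≡0 A
  ∣A△A∣≡0 (false ∷ A) = ∣A△A∣≡0 A

  subsets : ∀ n → List (Subset n)
  subsets zero    = [] ∷ []
  subsets (suc n) = cartesianProductWith _∷_ (true ∷ false ∷ []) (subsets n)

  ∈-subsets : ∀ {n} (A : Subset n) → A ∈ subsets n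
  ∈-subsets []          = here refl
  ∈-subsets (true  ∷ A) = ∈-cartesianProductWith⁺ _∷_ {xs = true ∷ false ∷ []}
                            (here refl) (∈-subsets A)
  ∈-subsets (false ∷ A) = ∈-cartesianProductWith⁺ _∷_ {xs = true ∷ false ∷ []}
                            (there (here refl)) (∈-subsets A)

Q : ℕ → FiniteSimpleGraph
Q n = record
  { V          = Subset n
  ; _∼_        = λ A B → ∣ A △ B ∣ ≡ 1
  ; ∼-sym      = λ {A} {B} → trans (cong ∣_∣ (∪-comm (B ─ A) (A ─ B)))
  ; ∼-irrefl   = λ {A} eq → contradiction (trans (sym (∣A△A∣≡0 A)) eq) λ ()
  ; _≟_        = Vec.≡-dec Bool._≟_
  ; _∼?_       = λ A B → ∣ A △ B ∣ ℕ.≟ 1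
  ; vertices   = subsets n
  ; ∈-vertices = ∈-subsets
  }

-- A real number is represented by the set of fractions below it, which is
-- enough to compare it with rationals: `x a b` means a/b ≤ x (for b > 0).
-- No negative fractions are recorded.
LowerCut : Set₁
LowerCut = ℕ → ℕ → Set

fromℕ : ℕ → LowerCut
fromℕ n a b = a ≤ n * b

-- For x ≥ 0, a/b ≤ log₂ x iff 2^(a/b) ≤ x iff every fraction p/q below 2^(a/b)
-- satisfies p/q ≤ x; and p/q < 2^(a/b) iff p^b < 2^a * q^b, which excludes q = 0.
log₂ : LowerCut → LowerCut
log₂ x a b = ∀ p q → p ^ b < 2 ^ a * q ^ b → x p q

-- k ≤ C · x, for C > 0, in the form k / C ≤ x.
infix 4 _≤_·_
_≤_·_ : ℕ → ℚ → LowerCut → Set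
k ≤ C · x = x (k * ↧ₙ C) ℤ.∣ ↥ C ∣

{-# OPTIONS --safe #-}

-- Lower bound.  By Ramsey's theorem every colouring of a large cube with q colours
-- depends only on the size on the subsets of some T with ∣T∣ > 2q.  Three layers of
-- T then have the same colour, and a geodesic from the lowest to the highest of them
-- has to meet the middle one.
--
-- Upper bound.  Let n ≤ 2^(2^h).  A set A is coloured by ∣A∣ mod g, for g a large
-- multiple of h, and by two bits.  A geodesic between two sets of one colour first
-- exchanges elements while staying within two layers and then climbs; it remains to
-- see that it can avoid its colour on the layers ≡ ∣A∣ mod g, that is, that the two
-- bits are not constant on a middle layer of an interval [u , y] of dimension ≥ g.
-- Each bit is the parity of the number of k-subsets of A with a property P, a
-- polynomial of degree k over 𝔽₂.  Its alternating sum over the transversals of k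
-- disjoint pairs in Z = y ∖ u sees only the part of degree k, hence does not depend
-- on u: it is the number of transversals with property P, and it suffices to find
-- pairs for which this number is odd.
-- Identify [n] with binary words of length m = 2^h, the leaves of a binary trie.
-- For the first bit P says that four words are balanced, i.e. split two and two where
-- they first differ.  If x₁,…,x₄ ∈ Z are balanced and e₁,…,e₄ ∈ Z branch off above
-- them one after the other, then every other transversal of the pairs (eᵢ , xᵢ)
-- is unbalanced.  A large Z without such elements contains a long comb, whose
-- branching coordinates are words of length h when the m coordinates are numbered in
-- binary.  For the second bit P says that the four coordinates at which the trie of
-- five words branches are balanced as words of length h.  Since a trie of depth h has
-- no combs longer than h + 1, a comb in Z longer than a multiple of h has suitable
-- pairs again.
module Submission where

open import Defs
open import Data.Nat.Base using (ℕ; _≤_; _<_)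
open import Data.Product.Base using (_×_; ∃-syntax)
open import Data.Rational.Base as ℚ using (ℚ; 0ℚ)

open import Algebra.Properties.CommutativeSemigroup using (interchange)
open import Data.Bool.Base using (Bool; true; false; if_then_else_; _∧_; _xor_; not)
import Data.Bool.Properties as Bool
open import Data.Bool.Solver using (module xor-∧-Solver)
open import Data.Empty using (⊥)
open import Data.Fin.Base as Fin using (Fin; zero; suc; toℕ)
import Data.Fin.Properties as Fin
open import Data.Fin.Subset using (Subset; ∣_∣) renaming (⊤ to full; ⊥ to ∅)
open import Data.Fin.Subset.Properties using (∣⊤∣≡n; ∣⊥∣≡0)
import Data.Integer.Base as ℤ
open import Data.List.Base using (List; []; _∷_; _++_; length; map; last; upTo; take; drop)
open import Data.List.Membership.Propositional using (_∈_)
import Data.List.Properties as List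
open import Data.List.Relation.Binary.Permutation.Propositional
  using (_↭_; refl; prep; swap; ↭-sym; ↭-trans; ↭-reflexive)
import Data.List.Relation.Binary.Permutation.Propositional.Properties as ↭
open import Data.List.Relation.Binary.Sublist.Propositional
  using (_⊆_; []; _∷_; _∷ʳ_; ⊆-refl; ⊆-trans)
import Data.List.Relation.Binary.Sublist.Propositional.Properties as ⊆
open import Data.List.Relation.Unary.All as All using (All; []; _∷_)
open import Data.List.Relation.Unary.AllPairs using ([]; _∷_)
open import Data.List.Relation.Unary.Any using (here; there)
open import Data.List.Relation.Unary.Linked using (Linked; [-]; _∷_)
open import Data.List.Relation.Unary.Unique.Propositional using (Unique)
open import Data.Maybe.Base using (just)
open import Data.Nat.Base
  using (zero; suc; _+_; _*_; _∸_; _^_; z≤n; s≤s; s≤s⁻¹; NonZero; nonZero; >-nonZero)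
open import Data.Nat.Coprimality as Coprime using (1-coprimeTo)
open import Data.Nat.DivMod as ℕ using (_%_; _/_)
import Data.Nat.Properties as ℕ
open import Data.List.Sort.InsertionSort ℕ.≤-decTotalOrder using (sort)
open import Data.List.Sort.InsertionSort.Properties ℕ.≤-decTotalOrder using (sort-↭)
open import Data.Product.Base using (_,_; proj₁; proj₂)
open import Data.Rational.Base using (mkℚ)
import Data.Rational.Properties as ℚ
open import Data.Sum.Base as Sum using (_⊎_; inj₁; inj₂; [_,_]′)
open import Data.Unit.Base using (⊤; tt)
open import Data.Vec.Base as Vec using (Vec; []; _∷_; lookup; _[_]≔_)
open import Data.Vec.Properties using (toList∘fromList; lookup∘tabulate)
open import Function.Base using (_∘_; id)
open import Relation.Binary.PropositionalEquality
  using (_≡_; _≢_; refl; sym; trans; cong; cong₂; subst; subst₂)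
open import Relation.Nullary using (¬_; yes; no)
open import Relation.Nullary.Decidable using (does; ¬?; decidable-stable; _×-dec_)
open import Relation.Nullary.Negation using (contradiction)

private variable
  X Y : Set

-- Geodesics in the cube

dist : ∀ {n} → Subset n → Subset n → ℕ
dist []      []      = 0
dist (a ∷ A) (b ∷ B) = if a xor b then suc (dist A B) else dist A B

∣△∣≡dist : ∀ {n} (A B : Subset n) → ∣ A △ B ∣ ≡ dist A B
∣△∣≡dist []          []          = refl
∣△∣≡dist (true  ∷ A) (true  ∷ B) = ∣△∣≡dist A B
∣△∣≡dist (true  ∷ A) (false ∷ B) = cong suc (∣△∣≡dist A B)
∣△∣≡dist (false ∷ A) (true  ∷ B) = cong suc (∣△∣≡dist A B)
∣△∣≡dist (false ∷ A) (false ∷ B) = ∣△∣≡dist A B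

dist-refl : ∀ {n} (A : Subset n) → dist A A ≡ 0
dist-refl []          = refl
dist-refl (true  ∷ A) = dist-refl A
dist-refl (false ∷ A) = dist-refl A

dist-triangle : ∀ {n} (A B C : Subset n) → dist A C ≤ dist A B + dist B C
dist-triangle []          []          []          = z≤n
dist-triangle (true  ∷ A) (true  ∷ B) (true  ∷ C) = dist-triangle A B C
dist-triangle (true  ∷ A) (true  ∷ B) (false ∷ C) =
  ℕ.≤-trans (s≤s (dist-triangle A B C)) (ℕ.≤-reflexive (sym (ℕ.+-suc _ _)))
dist-triangle (true  ∷ A) (false ∷ B) (true  ∷ C) =
  ℕ.m≤n⇒m≤1+n (ℕ.≤-trans (dist-triangle A B C) (ℕ.+-monoʳ-≤ _ (ℕ.n≤1+n _)))
dist-triangle (true  ∷ A) (false ∷ B) (false ∷ C) = s≤s (dist-triangle A B C)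
dist-triangle (false ∷ A) (true  ∷ B) (true  ∷ C) = s≤s (dist-triangle A B C)
dist-triangle (false ∷ A) (true  ∷ B) (false ∷ C) =
  ℕ.m≤n⇒m≤1+n (ℕ.≤-trans (dist-triangle A B C) (ℕ.+-monoʳ-≤ _ (ℕ.n≤1+n _)))
dist-triangle (false ∷ A) (false ∷ B) (true  ∷ C) =
  ℕ.≤-trans (s≤s (dist-triangle A B C)) (ℕ.≤-reflexive (sym (ℕ.+-suc _ _)))
dist-triangle (false ∷ A) (false ∷ B) (false ∷ C) = dist-triangle A B C

dist-flip : ∀ {n} (A B : Subset n) i → lookup A i ≢ lookup B i →
            suc (dist (A [ i ]≔ lookup B i) B) ≡ dist A B
dist-flip (true  ∷ A) (true  ∷ B) zero    a≢b = contradiction refl a≢b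
dist-flip (true  ∷ A) (false ∷ B) zero    a≢b = refl
dist-flip (false ∷ A) (true  ∷ B) zero    a≢b = refl
dist-flip (false ∷ A) (false ∷ B) zero    a≢b = contradiction refl a≢b
dist-flip (true  ∷ A) (true  ∷ B) (suc i) a≢b = dist-flip A B i a≢b
dist-flip (true  ∷ A) (false ∷ B) (suc i) a≢b = cong suc (dist-flip A B i a≢b)
dist-flip (false ∷ A) (true  ∷ B) (suc i) a≢b = cong suc (dist-flip A B i a≢b)
dist-flip (false ∷ A) (false ∷ B) (suc i) a≢b = dist-flip A B i a≢b

dist-flipped : ∀ {n} (A : Subset n) i {b} → lookup A i ≢ b → dist A (A [ i ]≔ b) ≡ 1
dist-flipped (true  ∷ A) zero    {true}  a≢b = contradiction refl a≢b
dist-flipped (true  ∷ A) zero    {false} a≢b = cong suc (dist-refl A)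
dist-flipped (false ∷ A) zero    {true}  a≢b = cong suc (dist-refl A)
dist-flipped (false ∷ A) zero    {false} a≢b = contradiction refl a≢b
dist-flipped (true  ∷ A) (suc i)         a≢b = dist-flipped A i a≢b
dist-flipped (false ∷ A) (suc i)         a≢b = dist-flipped A i a≢b

∣∣≤∣∣+dist : ∀ {n} (A B : Subset n) → ∣ B ∣ ≤ ∣ A ∣ + dist A B
∣∣≤∣∣+dist []          []          = z≤n
∣∣≤∣∣+dist (true  ∷ A) (true  ∷ B) = s≤s (∣∣≤∣∣+dist A B)
∣∣≤∣∣+dist (true  ∷ A) (false ∷ B) =
  ℕ.m≤n⇒m≤1+n (ℕ.≤-trans (∣∣≤∣∣+dist A B) (ℕ.+-monoʳ-≤ _ (ℕ.n≤1+n _)))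
∣∣≤∣∣+dist (false ∷ A) (true  ∷ B) =
  ℕ.≤-trans (s≤s (∣∣≤∣∣+dist A B)) (ℕ.≤-reflexive (sym (ℕ.+-suc _ _)))
∣∣≤∣∣+dist (false ∷ A) (false ∷ B) = ∣∣≤∣∣+dist A B

lookup-ext : ∀ {n} {A B : Subset n} → (∀ i → lookup A i ≡ lookup B i) → A ≡ B
lookup-ext {A = []}    {[]}    _ = refl
lookup-ext {A = a ∷ A} {b ∷ B} p = cong₂ _∷_ (p zero) (lookup-ext (p ∘ suc))

infix 4 _⊑_
-- A record, because the bare function type mentions `A` and `B` only under `lookup`, from which
-- they could not be inferred.
record _⊑_ {n} (A B : Subset n) : Set where
  constructor ⊑-by
  field at : ∀ i → lookup A i ≡ true → lookup B i ≡ true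
open _⊑_

⊑-tail : ∀ {n a b} {A B : Subset n} → (a ∷ A) ⊑ (b ∷ B) → A ⊑ B
⊑-tail p .at i = at p (suc i)

⊑-refl : ∀ {n} {A : Subset n} → A ⊑ A
⊑-refl .at _ p = p

⊑-trans : ∀ {n} {A B C : Subset n} → A ⊑ B → B ⊑ C → A ⊑ C
⊑-trans p q .at i = at q i ∘ at p i

∣∣-mono : ∀ {n} {A B : Subset n} → A ⊑ B → ∣ A ∣ ≤ ∣ B ∣
∣∣-mono {A = []}        {[]}        p = z≤n
∣∣-mono {A = true  ∷ A} {true  ∷ B} p = s≤s (∣∣-mono (⊑-tail p))
∣∣-mono {A = true  ∷ A} {false ∷ B} p = contradiction (at p zero refl) λ ()
∣∣-mono {A = false ∷ A} {true  ∷ B} p = ℕ.m≤n⇒m≤1+n (∣∣-mono (⊑-tail p))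
∣∣-mono {A = false ∷ A} {false ∷ B} p = ∣∣-mono (⊑-tail p)

⊑-size : ∀ {n} {A B : Subset n} → A ⊑ B → ∣ B ∣ ≤ ∣ A ∣ → A ≡ B
⊑-size {A = []}        {[]}        p s       = refl
⊑-size {A = true  ∷ A} {true  ∷ B} p (s≤s s) = cong (true ∷_) (⊑-size (⊑-tail p) s)
⊑-size {A = true  ∷ A} {false ∷ B} p s       = contradiction (at p zero refl) λ ()
⊑-size {A = false ∷ A} {true  ∷ B} p s       =
  contradiction (∣∣-mono (⊑-tail p)) (ℕ.<⇒≱ s)
⊑-size {A = false ∷ A} {false ∷ B} p s       = cong (false ∷_) (⊑-size (⊑-tail p) s)

missing? : ∀ {n} (A B : Subset n) →
           (∃[ i ] lookup A i ≡ false × lookup B i ≡ true) ⊎ B ⊑ A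
missing? A B with Fin.any? (λ i → (lookup A i Bool.≟ false) ×-dec (lookup B i Bool.≟ true))
... | yes p = inj₁ p
... | no ¬p = inj₂ (⊑-by λ i Bi → Bool.¬-not λ Ai → ¬p (i , Ai , Bi))

missing : ∀ {n} (A B : Subset n) → ∣ A ∣ < ∣ B ∣ →
          ∃[ i ] lookup A i ≡ false × lookup B i ≡ true
missing A B s with missing? A B
... | inj₁ p = p
... | inj₂ q = contradiction (∣∣-mono q) (ℕ.<⇒≱ s)

∣insert∣ : ∀ {n} (A : Subset n) i → lookup A i ≡ false → ∣ A [ i ]≔ true ∣ ≡ suc ∣ A ∣
∣insert∣ (false ∷ A) zero    p = refl
∣insert∣ (true  ∷ A) (suc i) p = cong suc (∣insert∣ A i p)
∣insert∣ (false ∷ A) (suc i) p = ∣insert∣ A i p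

∣delete∣ : ∀ {n} (A : Subset n) i → lookup A i ≡ true → suc ∣ A [ i ]≔ false ∣ ≡ ∣ A ∣
∣delete∣ (true  ∷ A) zero    p = refl
∣delete∣ (true  ∷ A) (suc i) p = cong suc (∣delete∣ A i p)
∣delete∣ (false ∷ A) (suc i) p = ∣delete∣ A i p

lookup-updated : ∀ {n} (A : Subset n) i b → lookup (A [ i ]≔ b) i ≡ b
lookup-updated (_ ∷ A) zero    b = refl
lookup-updated (_ ∷ A) (suc i) b = lookup-updated A i b

lookup-update : ∀ {n} (A : Subset n) i b j →
  (j ≡ i × lookup (A [ i ]≔ b) j ≡ b) ⊎ lookup (A [ i ]≔ b) j ≡ lookup A j
lookup-update (_ ∷ A) zero    b zero    = inj₁ (refl , refl)
lookup-update (_ ∷ A) zero    b (suc j) = inj₂ refl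
lookup-update (_ ∷ A) (suc i) b zero    = inj₂ refl
lookup-update (_ ∷ A) (suc i) b (suc j) with lookup-update A i b j
... | inj₁ (refl , p) = inj₁ (refl , p)
... | inj₂ p          = inj₂ p

insert-⊑ : ∀ {n} {A B : Subset n} {i} → A ⊑ B → lookup B i ≡ true → (A [ i ]≔ true) ⊑ B
insert-⊑ {A = A} {i = i} p q .at j r with lookup-update A i true j
... | inj₁ (refl , _) = q
... | inj₂ s          = at p j (trans (sym s) r)

⊑-insert : ∀ {n} (A : Subset n) i → A ⊑ (A [ i ]≔ true)
⊑-insert A i .at j r with lookup-update A i true j
... | inj₁ (_ , s) = s
... | inj₂ s       = trans s r

between : ∀ {n} k {A B : Subset n} → A ⊑ B → ∣ A ∣ + k ≤ ∣ B ∣ →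
          ∃[ C ] A ⊑ C × C ⊑ B × ∣ C ∣ ≡ ∣ A ∣ + k
between zero    {A} {B} p s = A , ⊑-refl , p , sym (ℕ.+-identityʳ _)
between (suc k) {A} {B} p s with missing A B (ℕ.<-≤-trans (ℕ.m<m+n _ (s≤s z≤n)) s)
... | i , Ai , Bi =
  let eq = trans (cong (_+ k) (∣insert∣ A i Ai)) (sym (ℕ.+-suc _ k))
      C , p′ , q′ , t = between k (insert-⊑ p Bi) (ℕ.≤-trans (ℕ.≤-reflexive eq) s)
  in C , ⊑-trans (⊑-insert A i) p′ , q′ , trans t eq

dist-linked : ∀ {n} {u v : Subset n} xs → Linked (FiniteSimpleGraph._∼_ (Q n)) (u ∷ xs) →
              last (u ∷ xs) ≡ just v → dist u v ≤ length xs
dist-linked {u = u} [] [-] refl = ℕ.≤-reflexive (dist-refl u)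
dist-linked {u = u} {v} (x ∷ xs) (u∼x ∷ l) e = ℕ.≤-trans (dist-triangle u x v)
  (ℕ.+-mono-≤ (ℕ.≤-reflexive (trans (sym (∣△∣≡dist u x)) u∼x)) (dist-linked xs l e))

dist<length : ∀ {n} {u v : Subset n} xs → IsPath (Q n) u v xs → dist u v < length xs
dist<length (x ∷ xs) (isPath refl e l _) = s≤s (dist-linked xs l e)

-- A geodesic that avoids M except at its ends.
data Route {n} (M : Subset n → Set) : Subset n → Subset n → Set where
  stay : ∀ {v} → Route M v v
  move : ∀ {u v} i → lookup u i ≢ lookup v i →
         u [ i ]≔ lookup v i ≡ v ⊎ ¬ M (u [ i ]≔ lookup v i) →
         Route M (u [ i ]≔ lookup v i) v → Route M u v

module _ {n} {M : Subset n → Set} where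

  trace : ∀ {u v} → Route M u v → List (Subset n)
  trace stay           = []
  trace (move {u} {v} i _ _ r) = (u [ i ]≔ lookup v i) ∷ trace r

  trace-length : ∀ {u v} (r : Route M u v) → length (trace r) ≡ dist u v
  trace-length (stay {v})           = sym (dist-refl v)
  trace-length (move {u} {v} i d _ r) = trans (cong suc (trace-length r)) (dist-flip u v i d)

  trace-linked : ∀ {u v} (r : Route M u v) → Linked (FiniteSimpleGraph._∼_ (Q n)) (u ∷ trace r)
  trace-linked stay                   = [-]
  trace-linked (move {u} i d _ r) =
    trans (∣△∣≡dist u _) (dist-flipped u i d) ∷ trace-linked r

  trace-last : ∀ {u v} (r : Route M u v) → last (u ∷ trace r) ≡ just v
  trace-last stay           = refl
  trace-last (move i _ _ r) = trace-last r

  -- Each move corrects one coordinate. The strict decrease is what makes the vertices of a trace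
  -- distinct.
  trace-dist : ∀ {u v} (r : Route M u v) → All (λ x → dist x v < dist u v) (trace r)
  trace-dist stay                   = []
  trace-dist (move {u} {v} i d _ r) =
    lt ∷ All.map (λ p → ℕ.<-trans p lt) (trace-dist r)
    where lt = ℕ.≤-reflexive (dist-flip u v i d)

  trace-unique : ∀ {u v} (r : Route M u v) → Unique (u ∷ trace r)
  trace-unique stay = [] ∷ []
  trace-unique r@(move {u} {v} i d _ s) =
    All.map (λ { p refl → ℕ.<-irrefl refl p }) (trace-dist r) ∷ trace-unique s

  trace-avoids : ∀ {u v} (r : Route M u v) → All (λ x → x ≡ v ⊎ ¬ M x) (trace r)
  trace-avoids stay           = []
  trace-avoids (move _ _ a r) = a ∷ trace-avoids r

  -- The trace has `dist u v` edges, and by `dist<length` no path has fewer.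
  route⇒visible : ∀ {u v} → Route M u v →
    ∃[ xs ] IsShortestPath (Q n) u v xs × (∀ x → x ∈ xs → x ≢ u → x ≢ v → ¬ M x)
  route⇒visible {u} r = u ∷ trace r ,
    (isPath refl (trace-last r) (trace-linked r) (trace-unique r) ,
     λ ys p → subst (_≤ length ys) (cong suc (sym (trace-length r))) (dist<length ys p)) ,
    λ { _ (here refl) x≢u _ → contradiction refl x≢u
      ; x (there x∈)  _ x≢v → [ (λ x≡v → contradiction x≡v x≢v) , id ]′
                                (All.lookup (trace-avoids r) x∈) }

  -- Membership of `w` in the interval of `u` and `v`, that is, lying on some geodesic between them.
  Between : Subset n → Subset n → Subset n → Set
  Between u w v = ∀ i → lookup w i ≡ lookup u i ⊎ lookup w i ≡ lookup v i

  -- A move towards `w` flips a coordinate at which `u` and `w` differ; there `w` agrees with `v`,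
  -- so it is a move towards `v` as well. The first route puts no constraint on its end `w`, hence
  -- the second hypothesis.
  route-trans : ∀ {u w v} → Between u w v → w ≡ v ⊎ ¬ M w →
                Route M u w → Route M w v → Route M u v
  route-trans b a stay s = s
  route-trans {u} {w} {v} b a (move i d c r) s = go (b i)
    where
    go : lookup w i ≡ lookup u i ⊎ lookup w i ≡ lookup v i → Route M u v
    go (inj₁ e) = contradiction (sym e) d
    go (inj₂ e) = move i (λ e′ → d (trans e′ (sym e)))
                    (subst (λ x → u [ i ]≔ x ≡ v ⊎ ¬ M (u [ i ]≔ x)) e c′)
                    (subst (λ x → Route M (u [ i ]≔ x) v) e (route-trans b′ a r s))
      where
      x = u [ i ]≔ lookup w i
      c″ : x ≡ w ⊎ ¬ M x → w ≡ v ⊎ ¬ M w → x ≡ v ⊎ ¬ M x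
      c″ (inj₂ ¬m) _          = inj₂ ¬m
      c″ (inj₁ e₂) (inj₁ w≡v) = inj₁ (trans e₂ w≡v)
      c″ (inj₁ e₂) (inj₂ ¬m)  = inj₂ (subst (¬_ ∘ M) (sym e₂) ¬m)
      c′ = c″ c a
      b′ : Between (u [ i ]≔ lookup w i) w v
      b′ j with lookup-update u i (lookup w i) j
      ... | inj₁ (refl , q) = inj₁ (sym q)
      ... | inj₂ q with b j
      ...   | inj₁ p = inj₁ (trans p (sym q))
      ...   | inj₂ p = inj₂ p

  route-sym : ∀ {u v} → Route M u v → Route M v u
  route-sym stay = stay
  route-sym (move {u} {v} i d a r) =
    -- If the first vertex after `u` is already `v`, it may lie in `M`, and the reverse route is the
    -- single move `back`. Otherwise `back` is appended to the reversed rest.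
    [ (λ w≡v → subst (λ x → Route M x u) w≡v back)
    , (λ ¬Mw → route-trans btw (inj₂ ¬Mw) (route-sym r) back) ]′ a
    where
    w = u [ i ]≔ lookup v i
    wi : lookup w i ≡ lookup v i
    wi = lookup-updated u i _
    undo : w [ i ]≔ lookup u i ≡ u
    undo = lookup-ext λ j → eq j (lookup-update w i (lookup u i) j) (lookup-update u i (lookup v i) j)
      where
      eq : ∀ j → (j ≡ i × lookup (w [ i ]≔ lookup u i) j ≡ lookup u i)
               ⊎ lookup (w [ i ]≔ lookup u i) j ≡ lookup w j →
             (j ≡ i × lookup w j ≡ lookup v i) ⊎ lookup w j ≡ lookup u j →
             lookup (w [ i ]≔ lookup u i) j ≡ lookup u j
      eq j (inj₁ (refl , p)) _                = p
      eq j (inj₂ p)          (inj₁ (refl , _)) = lookup-updated w j _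
      eq j (inj₂ p)          (inj₂ q)          = trans p q
    back : Route M w u
    back = move i (λ e → d (trans (sym e) wi)) (inj₁ undo) (subst (λ x → Route M x u) (sym undo) stay)
    btw : Between v w u
    btw j with lookup-update u i (lookup v i) j
    ... | inj₁ (refl , p) = inj₁ p
    ... | inj₂ p          = inj₂ p

-- Ramsey's theorem and the lower bound

⊑-cons : ∀ {n} b {A B : Subset n} → A ⊑ B → (b ∷ A) ⊑ (b ∷ B)
⊑-cons b p .at zero    q = q
⊑-cons b p .at (suc i) q = at p i q

⊑-false : ∀ {n b} {A B : Subset n} → A ⊑ B → (false ∷ A) ⊑ (b ∷ B)
⊑-false p .at (suc i) q = at p i q

∅-⊑ : ∀ {n} {A : Subset n} → ∅ ⊑ A
∅-⊑ {A = _ ∷ A} .at zero    ()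
∅-⊑ {A = _ ∷ A} .at (suc i) p = at (∅-⊑ {A = A}) i p

Homogeneous : ∀ {n} → ℕ → (Subset n → ℕ) → Subset n → ℕ → Set
Homogeneous d c T k = ∀ {A} → A ⊑ T → ∣ A ∣ ≡ d → c A ≡ k

-- The colour of a (d+1)-subset of T depends only on its least element.
MinDetermined : ∀ {n} → ℕ → (Subset n → ℕ) → Subset n → Vec ℕ n → Set
MinDetermined d c []          []       = ⊤
MinDetermined d c (true  ∷ T) (k ∷ ks) =
  Homogeneous d (c ∘ (true ∷_)) T k × MinDetermined d (c ∘ (false ∷_)) T ks
MinDetermined d c (false ∷ T) (k ∷ ks) = MinDetermined d (c ∘ (false ∷_)) T ks

-- Pigeonhole principle, by induction on the number of colours: either more than `m` elements have
-- the last colour, or discarding that colour leaves enough elements for the remaining ones.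
colour-class : ∀ {n} q m (T : Subset n) (ks : Vec ℕ n) →
  (∀ i → lookup T i ≡ true → lookup ks i < q) → q * m < ∣ T ∣ →
  ∃[ k ] ∃[ S ] k < q × S ⊑ T × m < ∣ S ∣ × (∀ i → lookup S i ≡ true → lookup ks i ≡ k)
colour-class {n} zero m T ks b s with missing ∅ T (subst (_< ∣ T ∣) (sym (∣⊥∣≡0 n)) s)
... | i , _ , Ti = contradiction (b i Ti) λ ()
colour-class {n} (suc q) m T ks b s = go (split T ks)
  where
  split : ∀ {n} (T : Subset n) (ks : Vec ℕ n) → ∃[ S ] ∃[ R ] S ⊑ T × R ⊑ T × ∣ S ∣ + ∣ R ∣ ≡ ∣ T ∣
    × (∀ i → lookup S i ≡ true → lookup ks i ≡ q) × (∀ i → lookup R i ≡ true → lookup ks i ≢ q)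
  split [] [] = [] , [] , ⊑-refl , ⊑-refl , refl , (λ ()) , (λ ())
  split (t ∷ T) (k ∷ ks) with split T ks
  split (false ∷ T) (k ∷ ks) | S , R , p , p′ , e , f , g = false ∷ S , false ∷ R ,
    ⊑-false p , ⊑-false p′ , e , (λ { (suc i) → f i }) , (λ { (suc i) → g i })
  split (true ∷ T) (k ∷ ks) | S , R , p , p′ , e , f , g with k ℕ.≟ q
  ... | yes k≡q = true ∷ S , false ∷ R , ⊑-cons true p , ⊑-false p′ , cong suc e ,
                  (λ { zero _ → k≡q ; (suc i) → f i }) , (λ { (suc i) → g i })
  ... | no  k≢q = false ∷ S , true ∷ R , ⊑-false p , ⊑-cons true p′ ,
                  trans (ℕ.+-suc _ _) (cong suc e) ,
                  (λ { (suc i) → f i }) , (λ { zero _ → k≢q ; (suc i) → g i })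
  go : _ → _
  go (S , R , p , p′ , e , f , g) with m ℕ.<? ∣ S ∣
  ... | yes m<S = q , S , ℕ.n<1+n q , p , m<S , f
  ... | no  m≮S =
    let k , S′ , k<q , p″ , m<S′ , f′ = colour-class q m R ks
          (λ i Ri → ℕ.≤∧≢⇒< (s≤s⁻¹ (b i (at p′ i Ri))) (g i Ri))
          (ℕ.+-cancelˡ-< m _ _ (ℕ.<-≤-trans s
            (ℕ.≤-trans (ℕ.≤-reflexive (sym e)) (ℕ.+-monoˡ-≤ _ (ℕ.≮⇒≥ m≮S)))))
    in k , S′ , ℕ.m<n⇒m<1+n k<q , ⊑-trans p″ p′ , m<S′ , f′

-- The first `true` of a set `A` of size `suc d` is its least element, whose entry in `ks` is the
-- colour of `A`; on `S` these entries all equal `k`.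
min-monochromatic : ∀ {n} d {c : Subset n → ℕ} {T S ks k} → MinDetermined d c T ks → S ⊑ T →
  (∀ i → lookup S i ≡ true → lookup ks i ≡ k) → Homogeneous (suc d) c S k
min-monochromatic d {T = []} {[]} {[]} _ _ _ {[]} _ ()
min-monochromatic d {T = true ∷ T} {s ∷ S} {x ∷ ks} (h , _) p f {true ∷ A} q e =
  trans (h (⊑-trans (⊑-tail q) (⊑-tail p)) (ℕ.suc-injective e)) (f zero (at q zero refl))
min-monochromatic d {T = false ∷ T} {s ∷ S} {x ∷ ks} _ p f {true ∷ A} q e =
  contradiction (at p zero (at q zero refl)) λ ()
min-monochromatic d {T = true ∷ T} {s ∷ S} {x ∷ ks} (_ , h) p f {false ∷ A} q e =
  min-monochromatic d h (⊑-tail p) (f ∘ suc) (⊑-tail q) e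
min-monochromatic d {T = false ∷ T} {s ∷ S} {x ∷ ks} h p f {false ∷ A} q e =
  min-monochromatic d h (⊑-tail p) (f ∘ suc) (⊑-tail q) e

Ramsey : ℕ → ℕ → ℕ → ℕ → Set
Ramsey q d m N = ∀ {n} (c : Subset n → ℕ) → (∀ A → c A < q) → ∀ S → N ≤ ∣ S ∣ →
  ∃[ T ] ∃[ k ] T ⊑ S × m ≤ ∣ T ∣ × k < q × Homogeneous d c T k

module _ (q d : ℕ) (ramsey-d : ∀ m → ∃[ N ] Ramsey q d m N) where

  -- The least element `x` of `S` induces a colouring of the `d`-subsets of the rest: add `x` and
  -- take the colour. The construction is repeated inside a set that is homogeneous for this
  -- colouring.
  min-determined : ∀ m → ∃[ N ] ∀ {n} (c : Subset n → ℕ) → (∀ A → c A < q) → ∀ S → N ≤ ∣ S ∣ →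
    ∃[ T ] ∃[ ks ] T ⊑ S × m ≤ ∣ T ∣ × (∀ i → lookup T i ≡ true → lookup ks i < q)
      × MinDetermined d c T ks
  min-determined zero = 0 , λ c _ S _ →
    ∅ , zeros′ , ∅-⊑ , z≤n , (λ i p → contradiction p (none i)) , trivial c
    where
    zeros′ : ∀ {n} → Vec ℕ n
    zeros′ {zero}  = []
    zeros′ {suc n} = 0 ∷ zeros′
    none : ∀ {n} (i : Fin n) → lookup ∅ i ≢ true
    none (suc i) = none i
    trivial : ∀ {n} (c : Subset n → ℕ) → MinDetermined d c ∅ zeros′
    trivial {zero}  c = tt
    trivial {suc n} c = trivial (c ∘ (false ∷_))
  -- One element serves as the least element of `T`; the other `N` contain a homogeneous set of size
  -- `M`, in which the remaining `m` elements are found.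
  min-determined (suc m) = suc N , build
    where
    M = proj₁ (min-determined m)
    N = proj₁ (ramsey-d M)
    build : ∀ {n} (c : Subset n → ℕ) → (∀ A → c A < q) → ∀ S → suc N ≤ ∣ S ∣ →
      ∃[ T ] ∃[ ks ] T ⊑ S × suc m ≤ ∣ T ∣ × (∀ i → lookup T i ≡ true → lookup ks i < q)
        × MinDetermined d c T ks
    build c b (false ∷ S) s =
      let T , ks , p , s′ , b′ , h = build (c ∘ (false ∷_)) (b ∘ (false ∷_)) S s
      in false ∷ T , 0 ∷ ks , ⊑-false p , s′ , (λ { (suc i) → b′ i }) , h
    build c b (true ∷ S) (s≤s s) =
      let T₁ , k , p₁ , s₁ , k<q , h₁ = proj₂ (ramsey-d M) (c ∘ (true ∷_)) (b ∘ (true ∷_)) S s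
          T , ks , p , s′ , b′ , h =
            proj₂ (min-determined m) (c ∘ (false ∷_)) (b ∘ (false ∷_)) T₁ s₁
      in true ∷ T , k ∷ ks , ⊑-cons true (⊑-trans p p₁) , s≤s s′ ,
         (λ { zero _ → k<q ; (suc i) → b′ i }) , (λ q′ → h₁ (⊑-trans q′ p)) , h

-- Induction on the size `d` of the coloured sets; pigeonhole on the colours of the least elements
-- turns a `MinDetermined` set into a homogeneous one.
ramsey : ∀ q d m → ∃[ N ] Ramsey q d m N
ramsey q zero m = m , λ c b S s → S , c ∅ , ⊑-refl , s , b ∅ ,
  λ {A} p e → cong c (sym (⊑-size ∅-⊑ (ℕ.≤-trans (ℕ.≤-reflexive e) z≤n)))
ramsey q (suc d) m =
  let N , f = min-determined q d (ramsey q d) (suc (q * m))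
  in N , λ c b S s →
    let T , ks , p , s₁ , b′ , h = f c b S s
        k , R , k<q , r , s₂ , e = colour-class q m T ks b′ s₁
    in R , k , ⊑-trans r p , ℕ.<⇒≤ s₂ , k<q , min-monochromatic d h r e

-- Ramsey's theorem is applied for one size after another, each time inside the previous set;
-- homogeneity passes to subsets.
ramsey-layers : ∀ q d m → ∃[ N ] ∀ {n} (c : Subset n → ℕ) → (∀ A → c A < q) → ∀ S → N ≤ ∣ S ∣ →
  ∃[ T ] ∃[ φ ] T ⊑ S × m ≤ ∣ T ∣ × (∀ j → φ j < q) ×
    (∀ {A} → A ⊑ T → ∣ A ∣ < d → c A ≡ φ ∣ A ∣)
ramsey-layers q zero m = m , λ c b S s →
  S , (λ _ → c ∅) , ⊑-refl , s , (λ _ → b ∅) , λ _ ()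
ramsey-layers q (suc d) m =
  let M , f = ramsey q d m
      N , g = ramsey-layers q d M
  in N , λ c b S s →
    let T₁ , φ , p₁ , s₁ , φ<q , h₁ = g c b S s
        T , k , p , s₂ , k<q , h = f c b T₁ s₁
    in T , extend φ k , ⊑-trans p p₁ , s₂ , (λ j → extend< φ φ<q k<q j) ,
       λ {A} r A<1+d → extend≡ φ (λ A<d → h₁ (⊑-trans r p) A<d) (λ e → h r e) A<1+d
  where
  extend : (ℕ → ℕ) → ℕ → ℕ → ℕ
  extend φ k j with j ℕ.≟ d
  ... | yes _ = k
  ... | no  _ = φ j
  extend< : ∀ φ → (∀ j → φ j < q) → ∀ {k} → k < q → ∀ j → extend φ k j < q
  extend< φ φ<q k<q j with j ℕ.≟ d
  ... | yes _ = k<q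
  ... | no  _ = φ<q j
  extend≡ : ∀ φ {k x j} → (j < d → x ≡ φ j) → (j ≡ d → x ≡ k) → j < suc d → x ≡ extend φ k j
  extend≡ φ {j = j} f g j<1+d with j ℕ.≟ d
  ... | yes e = g e
  ... | no ¬e = f (ℕ.≤∧≢⇒< (s≤s⁻¹ j<1+d) ¬e)

-- Pigeonhole on the `2q + 1` values of `φ` at `0` to `2q`: one of the `q` colours is taken more
-- than twice.
three-equal : ∀ q (φ : ℕ → ℕ) → (∀ j → φ j < q) →
  ∃[ i ] ∃[ j ] ∃[ l ] i < j × j < l × l < suc (q * 2) × φ i ≡ φ j × φ l ≡ φ j
three-equal q φ φ<q =
  let ks = Vec.tabulate {n = suc (q * 2)} (φ ∘ toℕ)
      lk = λ i → lookup∘tabulate (φ ∘ toℕ) i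
      k , S , _ , _ , s , f = colour-class q 2 full ks
        (λ i _ → subst (_< q) (sym (lk i)) (φ<q (toℕ i)))
        (subst (q * 2 <_) (sym (∣⊤∣≡n (suc (q * 2)))) (ℕ.n<1+n _))
      i , j , l , i<j , j<l , Si , Sj , Sl = three S s
      φ≡k = λ i Si → trans (sym (lk i)) (f i Si)
  in toℕ i , toℕ j , toℕ l , i<j , j<l , Fin.toℕ<n l ,
     trans (φ≡k i Si) (sym (φ≡k j Sj)) , trans (φ≡k l Sl) (sym (φ≡k j Sj))
  where
  one : ∀ {n} (S : Subset n) → 0 < ∣ S ∣ → ∃[ i ] lookup S i ≡ true
  one (true  ∷ S) _ = zero , refl
  one (false ∷ S) s = let i , p = one S s in suc i , p
  two : ∀ {n} (S : Subset n) → 1 < ∣ S ∣ →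
    ∃[ i ] ∃[ j ] toℕ i < toℕ j × lookup S i ≡ true × lookup S j ≡ true
  two (true  ∷ S) (s≤s s) = let j , p = one S s in zero , suc j , s≤s z≤n , refl , p
  two (false ∷ S) s = let i , j , l , p , q = two S s in suc i , suc j , s≤s l , p , q
  three : ∀ {n} (S : Subset n) → 2 < ∣ S ∣ → ∃[ i ] ∃[ j ] ∃[ l ] toℕ i < toℕ j × toℕ j < toℕ l
    × lookup S i ≡ true × lookup S j ≡ true × lookup S l ≡ true
  three (true  ∷ S) (s≤s s) =
    let j , l , p , q , r = two S s in zero , suc j , suc l , s≤s z≤n , s≤s p , refl , q , r
  three (false ∷ S) s =
    let i , j , l , p , q , r = three S s in suc i , suc j , suc l , s≤s p , s≤s q , r

-- Shortest paths between nested sets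

dist≡0 : ∀ {n} (A B : Subset n) → dist A B ≡ 0 → A ≡ B
dist≡0 []          []          _ = refl
dist≡0 (true  ∷ A) (true  ∷ B) e = cong (true ∷_) (dist≡0 A B e)
dist≡0 (false ∷ A) (false ∷ B) e = cong (false ∷_) (dist≡0 A B e)

-- Deleting an element of `A`, or adding one outside `C`, would increase the distance to `C`.
towards : ∀ {n} (A B C : Subset n) → A ⊑ C → dist A B ≡ 1 → dist B C < dist A C → A ⊑ B × B ⊑ C
towards [] [] [] p () l
towards (true ∷ A) (b ∷ B) (false ∷ C) p e l = contradiction (at p zero refl) λ ()
towards (true ∷ A) (true ∷ B) (true ∷ C) p e l =
  let q , r = towards A B C (⊑-tail p) e l in ⊑-cons true q , ⊑-cons true r
towards (true ∷ A) (false ∷ B) (true ∷ C) p e l with dist≡0 A B (ℕ.suc-injective e)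
... | refl = contradiction l (ℕ.<-asym (ℕ.n<1+n _))
towards (false ∷ A) (false ∷ B) (true ∷ C) p e l =
  let q , r = towards A B C (⊑-tail p) e (s≤s⁻¹ l) in ⊑-false q , ⊑-false r
towards (false ∷ A) (false ∷ B) (false ∷ C) p e l =
  let q , r = towards A B C (⊑-tail p) e l in ⊑-false q , ⊑-false r
towards (false ∷ A) (true ∷ B) (true ∷ C) p e l with dist≡0 A B (ℕ.suc-injective e)
... | refl = ⊑-false ⊑-refl , ⊑-cons true (⊑-tail p)
towards (false ∷ A) (true ∷ B) (false ∷ C) p e l with dist≡0 A B (ℕ.suc-injective e)
... | refl = contradiction l (ℕ.<-asym (ℕ.n<1+n _))

-- The bound on `length ys` forces every step to approach `v`. By `towards` the sets then grow, one
-- element at a time, and cannot jump over size `j`.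
crosses-layer : ∀ {n} {x v : Subset n} ys j → Linked (FiniteSimpleGraph._∼_ (Q n)) (x ∷ ys) →
  last (x ∷ ys) ≡ just v → length ys ≤ dist x v → x ⊑ v → ∣ x ∣ ≤ j → j ≤ ∣ v ∣ →
  ∃[ y ] y ∈ (x ∷ ys) × x ⊑ y × y ⊑ v × ∣ y ∣ ≡ j
crosses-layer {x = x} ys j l e s p a b with ∣ x ∣ ℕ.≟ j
... | yes eq = x , here refl , ⊑-refl , p , eq
crosses-layer [] j [-] refl s p a b | no ¬eq = contradiction (ℕ.≤-antisym a b) ¬eq
crosses-layer {x = x} {v} (y ∷ ys) j (x∼y ∷ l) e s p a b | no ¬eq =
  let d≡1 = trans (sym (∣△∣≡dist x y)) x∼y
      q , r = towards x y v p d≡1 (ℕ.<-≤-trans (s≤s (dist-linked ys l e)) s)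
      tri = ℕ.≤-trans s (ℕ.≤-trans (dist-triangle x y v) (ℕ.≤-reflexive (cong (_+ dist y v) d≡1)))
      z , z∈ , y⊑z , z⊑v , eq = crosses-layer ys j l e (s≤s⁻¹ tri) r
        (ℕ.≤-trans (∣∣≤∣∣+dist x y) (ℕ.≤-trans
          (ℕ.≤-reflexive (trans (cong (∣ x ∣ +_) d≡1) (ℕ.+-comm ∣ x ∣ 1))) (ℕ.≤∧≢⇒< a ¬eq))) b
  in z , there z∈ , ⊑-trans q y⊑z , z⊑v , eq

-- Supplies a path with exactly `dist u v` edges, against which shortest paths are measured.
free-route : ∀ {n} k (u v : Subset n) → dist u v ≡ k → Route (λ _ → ⊥) u v
free-route zero u v e = subst (Route _ u) (dist≡0 u v e) stay
free-route (suc k) u v e with Fin.any? (λ i → ¬? (lookup u i Bool.≟ lookup v i))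
... | yes (i , d) =
  move i d (inj₂ id) (free-route k _ v (ℕ.suc-injective (trans (dist-flip u v i d) e)))
... | no ¬p with lookup-ext {A = u} {v} (λ i → decidable-stable (lookup u i Bool.≟ lookup v i) (λ d → ¬p (i , d)))
...   | refl = stay

geodesic-crosses-layer : ∀ {n} {u v : Subset n} {xs} j → IsShortestPath (Q n) u v xs → u ⊑ v →
  ∣ u ∣ ≤ j → j ≤ ∣ v ∣ → ∃[ y ] y ∈ xs × u ⊑ y × y ⊑ v × ∣ y ∣ ≡ j
geodesic-crosses-layer {n} {u} {v} {x ∷ xs} j (isPath refl e l _ , shortest) p a b =
  let r = free-route _ u v refl in crosses-layer xs j l e
       (ℕ.≤-trans (s≤s⁻¹ (shortest (u ∷ trace r) (proj₁ (proj₁ (proj₂ (route⇒visible r))))))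
         (ℕ.≤-reflexive (trace-length r))) p a b

layer-separates : ∀ {n k} {c : Subset n → Fin k} → IsMutualVisibilityColouring (Q n) c →
  ∀ {u v j} → u ⊑ v → c u ≡ c v → ∣ u ∣ < j → j < ∣ v ∣ →
  ¬ (∀ {y} → u ⊑ y → y ⊑ v → ∣ y ∣ ≡ j → c y ≡ c v)
layer-separates {c = c} C {u} {v} {j} u⊑v cu≡cv u<j j<v same with C (c v) u v cu≡cv refl
... | xs , sp , free with geodesic-crosses-layer j sp u⊑v (ℕ.<⇒≤ u<j) (ℕ.<⇒≤ j<v)
...   | y , y∈ , u⊑y , y⊑v , y≡j = free y y∈
        (λ y≡u → ℕ.<-irrefl (trans (cong ∣_∣ (sym y≡u)) y≡j) u<j)
        (λ y≡v → ℕ.<-irrefl (trans (sym y≡j) (cong ∣_∣ y≡v)) j<v)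
        (same u⊑y y⊑v y≡j)

chain : ∀ {n} {T : Subset n} {i l} → i < l → l ≤ ∣ T ∣ →
        ∃[ u ] ∃[ v ] u ⊑ v × v ⊑ T × ∣ u ∣ ≡ i × ∣ v ∣ ≡ l
chain {n} {T} {i} {l} i<l l≤T with between l {∅} {T} ∅-⊑ (subst (λ z → z + l ≤ ∣ T ∣) (sym (∣⊥∣≡0 n)) l≤T)
... | v , _ , v⊑T , v≡ with trans v≡ (cong (_+ l) (∣⊥∣≡0 n))
...   | v≡l with between i {∅} {v} ∅-⊑ (subst₂ (λ z y → z + i ≤ y) (sym (∣⊥∣≡0 n)) (sym v≡l) (ℕ.<⇒≤ i<l))
...     | u , _ , u⊑v , u≡ = u , v , u⊑v , v⊑T , trans u≡ (cong (_+ i) (∣⊥∣≡0 n)) , v≡l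

layered-colouring-bad : ∀ {n k} {c : Subset n → Fin k} → IsMutualVisibilityColouring (Q n) c →
  ∀ q {T} (φ : ℕ → ℕ) → (∀ j → φ j < q) → suc (q * 2) ≤ ∣ T ∣ →
  ¬ (∀ {A} → A ⊑ T → ∣ A ∣ < suc (q * 2) → toℕ (c A) ≡ φ ∣ A ∣)
layered-colouring-bad {c = c} C q {T} φ φ<q s h with three-equal q φ φ<q
... | i , j , l , i<j , j<l , l<d , φi , φl
  with chain {T = T} (ℕ.<-trans i<j j<l) (ℕ.≤-trans (ℕ.<⇒≤ l<d) s)
...   | u , v , u⊑v , v⊑T , refl , refl =
  layer-separates C u⊑v
    (Fin.toℕ-injective (trans (trans (h (⊑-trans u⊑v v⊑T) (ℕ.<-trans i<j j<d)) φi) (sym cv)))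
    i<j j<l λ y₁ y₂ e → Fin.toℕ-injective
      (trans (trans (h (⊑-trans y₂ v⊑T) (subst (_< _) (sym e) j<d)) (cong φ e)) (sym cv))
  where
  j<d = ℕ.<-trans j<l l<d
  cv = trans (h v⊑T l<d) φl

lower-bound : ∀ q → ∃[ n₀ ] ∀ n → n₀ ≤ n → q < χμ (Q n)
lower-bound q = N , λ n N≤n → ℕ.≰⇒> λ χ≤q → bad n N≤n χ≤q (proj₁ (χμ-isLeast (Q n)))
  where
  -- Used twice: the colour is controlled on the `2q + 1` sizes below `d`, and `T` has at least `d`
  -- elements, so that it has subsets of all these sizes.
  d = suc (q * 2)
  N = proj₁ (ramsey-layers q d d)
  bad : ∀ n → N ≤ n → ∀ {k} → k ≤ q → ¬ MutualVisibilityColourable (Q n) k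
  bad n N≤n k≤q (c , C) with proj₂ (ramsey-layers q d d) (toℕ ∘ c)
    (λ A → ℕ.<-≤-trans (Fin.toℕ<n (c A)) k≤q) full (subst (N ≤_) (sym (∣⊤∣≡n n)) N≤n)
  ... | T , φ , _ , s , φ<q , h = layered-colouring-bad C q φ φ<q s h

-- Polynomials over 𝔽₂

-- The parity of the number of `k`-element sublists of `A` on which `g` holds: a polynomial of
-- degree at most `k` over 𝔽₂ in the membership indicators.
parity : ℕ → (List X → Bool) → List X → Bool
parity zero    g A       = g []
parity (suc k) g []      = false
parity (suc k) g (x ∷ A) = parity k (g ∘ (x ∷_)) A xor parity (suc k) g A

Symmetric : {Y : Set} → (List X → Y) → Set
Symmetric g = ∀ {S T} → S ↭ T → g S ≡ g T

private
  swap-xor : ∀ a b c d → (a xor b) xor (c xor d) ≡ (a xor c) xor (b xor d)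
  swap-xor = solve 4 (λ a b c d → (a :+ b) :+ (c :+ d) := (a :+ c) :+ (b :+ d)) refl
    where open xor-∧-Solver

  -- For `dsum-parity`: the sublists that avoid the current pair contribute the same `c` for either
  -- element of the pair.
  cancel-xor : ∀ a b c → (a xor c) xor (b xor c) ≡ a xor b
  cancel-xor false false c = Bool.xor-same c
  cancel-xor false true  false = refl
  cancel-xor false true  true = refl
  cancel-xor true  false false = refl
  cancel-xor true  false true = refl
  cancel-xor true  true  c = Bool.xor-same (not c)

parity-cong : ∀ k {g h : List X → Bool} → (∀ S → g S ≡ h S) → ∀ A → parity k g A ≡ parity k h A
parity-cong zero    e A       = e []
parity-cong (suc k) e []      = refl
parity-cong (suc k) e (x ∷ A) =
  cong₂ _xor_ (parity-cong k (e ∘ (x ∷_)) A) (parity-cong (suc k) e A)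

parity-symmetric : ∀ k {g : List X → Bool} → Symmetric g → Symmetric (parity k g)
parity-symmetric k s refl = refl
parity-symmetric k s (_↭_.trans p q) = trans (parity-symmetric k s p) (parity-symmetric k s q)
parity-symmetric zero s (prep x p) = refl
parity-symmetric zero s (swap x y p) = refl
parity-symmetric (suc k) s (prep x p) =
  cong₂ _xor_ (parity-symmetric k (s ∘ prep x) p) (parity-symmetric (suc k) s p)
parity-symmetric (suc zero) {g} s (swap x y p) = trans
  (cong (λ z → g (x ∷ []) xor (g (y ∷ []) xor z)) (parity-symmetric 1 s p))
  (swap₃ (g (x ∷ [])) (g (y ∷ [])) _)
  where
  swap₃ : ∀ a b c → a xor (b xor c) ≡ b xor (a xor c)
  swap₃ = solve 3 (λ a b c → a :+ (b :+ c) := b :+ (a :+ c)) refl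
    where open xor-∧-Solver
-- The four terms count the sublists with both `x` and `y`, with `x` only, with `y` only and with
-- neither; exchanging `x` and `y` swaps the middle two.
parity-symmetric (suc (suc k)) {g} s (swap {xs = xs} x y p) = trans
  (swap-xor (parity k (λ S → g (x ∷ y ∷ S)) xs) _ _ _)
  (cong₂ _xor_
    (cong₂ _xor_
      (trans (parity-cong k (λ S → s (swap x y refl)) xs) (parity-symmetric k (s ∘ prep y ∘ prep x) p))
      (parity-symmetric (suc k) (s ∘ prep y) p))
    (cong₂ _xor_ (parity-symmetric (suc k) (s ∘ prep x) p) (parity-symmetric (suc (suc k)) s p)))

-- Signs vanish over 𝔽₂, so this sum over all transversals is an iterated difference, one for each
-- pair.
dsum : List (X × X) → (List X → Bool) → Bool
dsum []             g = g []
dsum ((x , y) ∷ ps) g = dsum ps (g ∘ (x ∷_)) xor dsum ps (g ∘ (y ∷_))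

dsum-cong : ∀ (ps : List (X × X)) {g h} → (∀ S → g S ≡ h S) → dsum ps g ≡ dsum ps h
dsum-cong []             e = e []
dsum-cong ((x , y) ∷ ps) e =
  cong₂ _xor_ (dsum-cong ps (e ∘ (x ∷_))) (dsum-cong ps (e ∘ (y ∷_)))

dsum-xor : ∀ (ps : List (X × X)) g h → dsum ps (λ S → g S xor h S) ≡ dsum ps g xor dsum ps h
dsum-xor []             g h = refl
dsum-xor ((x , y) ∷ ps) g h = trans
  (cong₂ _xor_ (dsum-xor ps (g ∘ (x ∷_)) (h ∘ (x ∷_))) (dsum-xor ps (g ∘ (y ∷_)) (h ∘ (y ∷_))))
  (swap-xor (dsum ps (g ∘ (x ∷_))) _ _ _)

dsum-map : ∀ (f : X → Y) (ps : List (X × X)) g →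
  dsum (map (λ (x , y) → f x , f y) ps) g ≡ dsum ps (g ∘ map f)
dsum-map f []             g = refl
dsum-map f ((x , y) ∷ ps) g = cong₂ _xor_ (dsum-map f ps _) (dsum-map f ps _)

-- The alternating sum over k pairs kills the part of `parity k g` of degree below k.
dsum-parity : ∀ (ps : List (X × X)) g A →
  dsum ps (λ S → parity (length ps) g (S ++ A)) ≡ dsum ps g
dsum-parity []             g A = refl
dsum-parity ((x , y) ∷ ps) g A = trans
  (cong₂ _xor_ (split x) (split y)) (cancel-xor (dsum ps (g ∘ (x ∷_))) _ _)
  where
  split : ∀ z → dsum ps (λ S → parity (suc (length ps)) g (z ∷ S ++ A))
              ≡ dsum ps (g ∘ (z ∷_)) xor dsum ps (λ S → parity (suc (length ps)) g (S ++ A))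
  split z = trans (dsum-xor ps _ _) (cong (_xor _) (dsum-parity ps (g ∘ (z ∷_)) A))

data Transversal {X : Set} : List (X × X) → List X → List X → Set where
  []     : Transversal [] [] []
  first  : ∀ {x y ps S R} → Transversal ps S R → Transversal ((x , y) ∷ ps) (x ∷ S) (y ∷ R)
  second : ∀ {x y ps S R} → Transversal ps S R → Transversal ((x , y) ∷ ps) (y ∷ S) (x ∷ R)

entries : List (X × X) → List X
entries []             = []
entries ((x , y) ∷ ps) = x ∷ y ∷ entries ps

transversal-↭ : ∀ {ps} {S R : List X} → Transversal ps S R → S ++ R ↭ entries ps
transversal-↭ [] = refl
transversal-↭ (first {x} {y} {S = S} {R} t) =
  prep x (↭-trans (↭.shift y S R) (prep y (transversal-↭ t)))
transversal-↭ (second {x} {y} {S = S} {R} t) =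
  ↭-trans (prep y (↭.shift x S R)) (swap y x (transversal-↭ t))

transversal-length : ∀ {ps} {S R : List X} → Transversal ps S R → length S ≡ length ps
transversal-length []         = refl
transversal-length (first t)  = cong suc (transversal-length t)
transversal-length (second t) = cong suc (transversal-length t)

-- A constant summed over the transversals of at least one pair is zero. The search stays in a half
-- with odd sum until one pair is left, on which `g` takes both values.
dsum-nonconstant : ∀ (p : X × X) ps g → dsum (p ∷ ps) g ≡ true → ∀ c →
  ∃[ S ] ∃[ R ] Transversal (p ∷ ps) S R × g S ≢ c
dsum-nonconstant (x , y) [] g e c with g (x ∷ []) in ex | g (y ∷ []) in ey
dsum-nonconstant (x , y) [] g e true  | true  | false =
  _ , _ , second [] , λ q → contradiction (trans (sym q) ey) λ ()
dsum-nonconstant (x , y) [] g e false | true  | false =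
  _ , _ , first [] , λ q → contradiction (trans (sym q) ex) λ ()
dsum-nonconstant (x , y) [] g e true  | false | true  =
  _ , _ , first [] , λ q → contradiction (trans (sym q) ex) λ ()
dsum-nonconstant (x , y) [] g e false | false | true  =
  _ , _ , second [] , λ q → contradiction (trans (sym q) ey) λ ()
dsum-nonconstant (x , y) (p ∷ ps) g e c with dsum (p ∷ ps) (g ∘ (x ∷_)) in ex
... | true  = let S , R , t , d = dsum-nonconstant p ps (g ∘ (x ∷_)) ex c in _ , _ , first t , d
... | false = let S , R , t , d = dsum-nonconstant p ps (g ∘ (y ∷_)) e  c in _ , _ , second t , d

-- Tries and their shapes

Code : ℕ → Set
Code = Vec Bool

zeros ones : ∀ {d} → List (Code (suc d)) → List (Code d)
zeros []                = []
zeros ((false ∷ v) ∷ T) = v ∷ zeros T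
zeros ((true  ∷ v) ∷ T) = zeros T
ones []                = []
ones ((false ∷ v) ∷ T) = ones T
ones ((true  ∷ v) ∷ T) = v ∷ ones T

pair nonempty : List X → Bool
pair (_ ∷ _ ∷ []) = true
pair _            = false
nonempty []      = false
nonempty (_ ∷ _) = true

branch : {X Y Z : Set} → X → List Y → List Z → List X
branch x Z O = if nonempty Z ∧ nonempty O then x ∷ [] else []

-- For four words at most one of the three terms holds, since fewer than four words are never
-- balanced; there `xor` acts as a disjunction.
balanced : ∀ {d} → List (Code d) → Bool
balanced {zero}  T = false
balanced {suc d} T =
  (pair (zeros T) ∧ pair (ones T)) xor (balanced (zeros T) xor balanced (ones T))

-- The labels of the coordinates at which the trie of T branches.
branchings : ∀ {d} → Vec X d → List (Code d) → List X
branchings []       T = []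
branchings (ℓ ∷ ℓs) T = branch ℓ (zeros T) (ones T) ++ branchings ℓs (zeros T) ++ branchings ℓs (ones T)

zeros-↭ : ∀ {d} {S T : List (Code (suc d))} → S ↭ T → zeros S ↭ zeros T
zeros-↭ refl = refl
zeros-↭ (prep (false ∷ v) p) = prep v (zeros-↭ p)
zeros-↭ (prep (true  ∷ v) p) = zeros-↭ p
zeros-↭ (swap (false ∷ v) (false ∷ w) p) = swap v w (zeros-↭ p)
zeros-↭ (swap (false ∷ v) (true  ∷ w) p) = prep v (zeros-↭ p)
zeros-↭ (swap (true  ∷ v) (false ∷ w) p) = prep w (zeros-↭ p)
zeros-↭ (swap (true  ∷ v) (true  ∷ w) p) = zeros-↭ p
zeros-↭ (_↭_.trans p q) = _↭_.trans (zeros-↭ p) (zeros-↭ q)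

ones-↭ : ∀ {d} {S T : List (Code (suc d))} → S ↭ T → ones S ↭ ones T
ones-↭ refl = refl
ones-↭ (prep (false ∷ v) p) = ones-↭ p
ones-↭ (prep (true  ∷ v) p) = prep v (ones-↭ p)
ones-↭ (swap (false ∷ v) (false ∷ w) p) = ones-↭ p
ones-↭ (swap (false ∷ v) (true  ∷ w) p) = prep w (ones-↭ p)
ones-↭ (swap (true  ∷ v) (false ∷ w) p) = prep v (ones-↭ p)
ones-↭ (swap (true  ∷ v) (true  ∷ w) p) = swap v w (ones-↭ p)
ones-↭ (_↭_.trans p q) = _↭_.trans (ones-↭ p) (ones-↭ q)

pair-length : (S : List X) (T : List Y) → length S ≡ length T → pair S ≡ pair T
pair-length []              []              e = refl
pair-length (_ ∷ [])        (_ ∷ [])        e = refl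
pair-length (_ ∷ _ ∷ [])    (_ ∷ _ ∷ [])    e = refl
pair-length (_ ∷ _ ∷ _ ∷ _) (_ ∷ _ ∷ _ ∷ _) e = refl

nonempty-length : (S : List X) (T : List Y) → length S ≡ length T → nonempty S ≡ nonempty T
nonempty-length []      []      e = refl
nonempty-length (_ ∷ _) (_ ∷ _) e = refl

pair-↭ : Symmetric (pair {X})
pair-↭ p = pair-length _ _ (↭.↭-length p)

nonempty-↭ : Symmetric (nonempty {X})
nonempty-↭ p = nonempty-length _ _ (↭.↭-length p)

balanced-↭ : ∀ {d} → Symmetric (balanced {d})
balanced-↭ {zero}  p = refl
balanced-↭ {suc d} p = cong₂ _xor_
  (cong₂ _∧_ (pair-↭ (zeros-↭ p)) (pair-↭ (ones-↭ p)))
  (cong₂ _xor_ (balanced-↭ (zeros-↭ p)) (balanced-↭ (ones-↭ p)))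

branchings-↭ : ∀ {d} (ℓs : Vec X d) → Symmetric (branchings ℓs)
branchings-↭ []       p = refl
branchings-↭ (ℓ ∷ ℓs) p = cong₂ _++_
  (cong (λ c → if c then ℓ ∷ [] else []) (cong₂ _∧_ (nonempty-↭ (zeros-↭ p)) (nonempty-↭ (ones-↭ p))))
  (cong₂ _++_ (branchings-↭ ℓs (zeros-↭ p)) (branchings-↭ ℓs (ones-↭ p)))

infixr 6 _⋆_
-- Shapes forget the coordinates on which all words agree. What remains is finite, so statements
-- about configurations can be checked by evaluation.
data Shape : Set where
  •   : Shape
  _⋆_ : Shape → Shape → Shape

Leaf Node : Shape → Set
Leaf •       = ⊤
Leaf (s ⋆ t) = Leaf s ⊎ Leaf t
Node •       = ⊥
Node (s ⋆ t) = ⊤ ⊎ (Node s ⊎ Node t)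

lefts : {A B : Set} → List (A ⊎ B) → List A
lefts []           = []
lefts (inj₁ x ∷ T) = x ∷ lefts T
lefts (inj₂ _ ∷ T) = lefts T

rights : {A B : Set} → List (A ⊎ B) → List B
rights []           = []
rights (inj₁ _ ∷ T) = rights T
rights (inj₂ y ∷ T) = y ∷ rights T

balancedₛ : ∀ s → List (Leaf s) → Bool
balancedₛ •       T = false
balancedₛ (s ⋆ t) T =
  (pair (lefts T) ∧ pair (rights T)) xor (balancedₛ s (lefts T) xor balancedₛ t (rights T))

branchingsₛ : ∀ s → List (Leaf s) → List (Node s)
branchingsₛ •       T = []
branchingsₛ (s ⋆ t) T = branch (inj₁ tt) (lefts T) (rights T)
  ++ map (inj₂ ∘ inj₁) (branchingsₛ s (lefts T)) ++ map (inj₂ ∘ inj₂) (branchingsₛ t (rights T))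

-- A trie of depth d homeomorphic to a given shape.
data Emb : Shape → ℕ → Set where
  pt   : ∀ {d} → Code d → Emb • d
  skip : ∀ {s d} → Bool → Emb s d → Emb s (suc d)
  fork : ∀ {s t d} → Bool → Emb s d → Emb t d → Emb (s ⋆ t) (suc d)

-- The Boolean of a `fork` is the bit of its left subtree; with `true` the shape is embedded
-- mirrored. This lets every comb be read with its teeth on the left.
code : ∀ {s d} → Emb s d → Leaf s → Code d
code (pt c)       _        = c
code (skip b e)   x        = b ∷ code e x
code (fork b e f) (inj₁ x) = b ∷ code e x
code (fork b e f) (inj₂ y) = not b ∷ code f y

label : ∀ {s d} → Emb s d → Vec X d → Node s → X
label (skip b e)   (ℓ ∷ ℓs) x               = label e ℓs x
label (fork b e f) (ℓ ∷ ℓs) (inj₁ tt)       = ℓ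
label (fork b e f) (ℓ ∷ ℓs) (inj₂ (inj₁ x)) = label e ℓs x
label (fork b e f) (ℓ ∷ ℓs) (inj₂ (inj₂ y)) = label f ℓs y

zeros-false : ∀ {d} (f : X → Code d) T → zeros (map (λ x → false ∷ f x) T) ≡ map f T
zeros-false f []      = refl
zeros-false f (x ∷ T) = cong (f x ∷_) (zeros-false f T)
zeros-true : ∀ {d} (f : X → Code d) T → zeros (map (λ x → true ∷ f x) T) ≡ []
zeros-true f []      = refl
zeros-true f (x ∷ T) = zeros-true f T
ones-true : ∀ {d} (f : X → Code d) T → ones (map (λ x → true ∷ f x) T) ≡ map f T
ones-true f []      = refl
ones-true f (x ∷ T) = cong (f x ∷_) (ones-true f T)
ones-false : ∀ {d} (f : X → Code d) T → ones (map (λ x → false ∷ f x) T) ≡ []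
ones-false f []      = refl
ones-false f (x ∷ T) = ones-false f T

balanced-[] : ∀ {d} → balanced {d} [] ≡ false
balanced-[] {zero}  = refl
balanced-[] {suc d} = cong₂ _xor_ (balanced-[] {d}) (balanced-[] {d})

branchings-[] : ∀ {d} (ℓs : Vec X d) → branchings ℓs [] ≡ []
branchings-[] []       = refl
branchings-[] (ℓ ∷ ℓs) = cong₂ _++_ (branchings-[] ℓs) (branchings-[] ℓs)

balanced-skip : ∀ {d} b (f : X → Code d) T → balanced (map (λ x → b ∷ f x) T) ≡ balanced (map f T)
balanced-skip {d = d} false f T rewrite zeros-false f T | ones-false f T | balanced-[] {d} =
  cong₂ _xor_ (Bool.∧-zeroʳ (pair (map f T))) (Bool.xor-identityʳ (balanced (map f T)))
balanced-skip {d = d} true f T rewrite zeros-true f T | ones-true f T | balanced-[] {d} = refl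

branchings-skip : ∀ {d} b ℓ (ℓs : Vec Y d) (f : X → Code d) T →
  branchings (ℓ ∷ ℓs) (map (λ x → b ∷ f x) T) ≡ branchings ℓs (map f T)
branchings-skip false ℓ ℓs f T rewrite zeros-false f T | ones-false f T | branchings-[] ℓs
  | Bool.∧-zeroʳ (nonempty (map f T)) = List.++-identityʳ _
branchings-skip true ℓ ℓs f T rewrite zeros-true f T | ones-true f T | branchings-[] ℓs = refl

module _ {d s t} (e : Emb s d) (f : Emb t d) where
  zeros-fork-false : ∀ T → zeros (map (code (fork false e f)) T) ≡ map (code e) (lefts T)
  zeros-fork-false []           = refl
  zeros-fork-false (inj₁ x ∷ T) = cong (code e x ∷_) (zeros-fork-false T)
  zeros-fork-false (inj₂ y ∷ T) = zeros-fork-false T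
  ones-fork-false : ∀ T → ones (map (code (fork false e f)) T) ≡ map (code f) (rights T)
  ones-fork-false []           = refl
  ones-fork-false (inj₁ x ∷ T) = ones-fork-false T
  ones-fork-false (inj₂ y ∷ T) = cong (code f y ∷_) (ones-fork-false T)
  zeros-fork-true : ∀ T → zeros (map (code (fork true e f)) T) ≡ map (code f) (rights T)
  zeros-fork-true []           = refl
  zeros-fork-true (inj₁ x ∷ T) = zeros-fork-true T
  zeros-fork-true (inj₂ y ∷ T) = cong (code f y ∷_) (zeros-fork-true T)
  ones-fork-true : ∀ T → ones (map (code (fork true e f)) T) ≡ map (code e) (lefts T)
  ones-fork-true []           = refl
  ones-fork-true (inj₁ x ∷ T) = cong (code e x ∷_) (ones-fork-true T)
  ones-fork-true (inj₂ y ∷ T) = ones-fork-true T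

balanced-const : ∀ {d} (c : Code d) (T : List X) → balanced (map (λ _ → c) T) ≡ false
balanced-const []      T = refl
balanced-const (b ∷ c) T = trans (balanced-skip b (λ _ → c) T) (balanced-const c T)

branchings-const : ∀ {d} (ℓs : Vec Y d) (c : Code d) (T : List X) → branchings ℓs (map (λ _ → c) T) ≡ []
branchings-const []       []      T = refl
branchings-const (ℓ ∷ ℓs) (b ∷ c) T =
  trans (branchings-skip b ℓ ℓs (λ _ → c) T) (branchings-const ℓs c T)

pair-map : (f : X → Y) (T : List X) → pair (map f T) ≡ pair T
pair-map f T = pair-length (map f T) T (List.length-map f T)

nonempty-map : (f : X → Y) (T : List X) → nonempty (map f T) ≡ nonempty T
nonempty-map f T = nonempty-length (map f T) T (List.length-map f T)

-- Coordinates on which all words agree contribute nothing, and `balanced` treats the two sides of a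
-- branching alike.
balanced-code : ∀ {s d} (e : Emb s d) T → balanced (map (code e) T) ≡ balancedₛ s T
balanced-code (pt c)     T = balanced-const c T
balanced-code (skip b e) T = trans (balanced-skip b (code e) T) (balanced-code e T)
balanced-code (fork false e f) T rewrite zeros-fork-false e f T | ones-fork-false e f T
  | pair-map (code e) (lefts T) | pair-map (code f) (rights T)
  | balanced-code e (lefts T) | balanced-code f (rights T) = refl
balanced-code {s ⋆ t} (fork true e f) T rewrite zeros-fork-true e f T | ones-fork-true e f T
  | pair-map (code e) (lefts T) | pair-map (code f) (rights T)
  | balanced-code e (lefts T) | balanced-code f (rights T) =
  cong₂ _xor_ (Bool.∧-comm (pair (rights T)) _) (Bool.xor-comm (balancedₛ t (rights T)) _)

-- Only a permutation, because a mirrored `fork` lists the branchings of its right subtree first.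
branchings-code : ∀ {s d} (e : Emb s d) (ℓs : Vec X d) T →
  branchings ℓs (map (code e) T) ↭ map (label e ℓs) (branchingsₛ s T)
branchings-code (pt c)     ℓs       T = ↭-reflexive (branchings-const ℓs c T)
branchings-code (skip b e) (ℓ ∷ ℓs) T =
  ↭-trans (↭-reflexive (branchings-skip b ℓ ℓs (code e) T)) (branchings-code e ℓs T)
branchings-code {s = s ⋆ t} (fork b e f) (ℓ ∷ ℓs) T = ↭-trans (split b)
  (↭-trans (↭.++⁺ (↭-reflexive (branch-map (nonempty (lefts T) ∧ nonempty (rights T))))
    (↭.++⁺ (↭-trans (branchings-code e ℓs (lefts T)) (↭-reflexive (List.map-∘ (branchingsₛ s (lefts T)))))
           (↭-trans (branchings-code f ℓs (rights T)) (↭-reflexive (List.map-∘ (branchingsₛ t (rights T)))))))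
  (↭-reflexive (sym (trans
    (List.map-++ g (branch (inj₁ tt) (lefts T) (rights T)) _)
    (cong (map g (branch (inj₁ tt) (lefts T) (rights T)) ++_)
      (List.map-++ g (map (inj₂ ∘ inj₁) (branchingsₛ s (lefts T))) _))))))
  where
  g = label (fork b e f) (ℓ ∷ ℓs)
  branch-map : ∀ c → (if c then ℓ ∷ [] else []) ≡ map g (if c then inj₁ tt ∷ [] else [])
  branch-map true  = refl
  branch-map false = refl
  E = branchings ℓs (map (code e) (lefts T))
  F = branchings ℓs (map (code f) (rights T))
  split : ∀ b → branchings (ℓ ∷ ℓs) (map (code (fork b e f)) T) ↭
          branch ℓ (lefts T) (rights T) ++ E ++ F
  split false rewrite zeros-fork-false e f T | ones-fork-false e f T
    | nonempty-map (code e) (lefts T) | nonempty-map (code f) (rights T) = refl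
  split true rewrite zeros-fork-true e f T | ones-fork-true e f T
    | nonempty-map (code e) (lefts T) | nonempty-map (code f) (rights T)
    | Bool.∧-comm (nonempty (rights T)) (nonempty (lefts T)) =
    ↭.++⁺ˡ (branch ℓ (lefts T) (rights T)) (↭.++-comm F E)

-- Configurations in large sets of words

⊆⇒↭ : {xs ys : List X} → xs ⊆ ys → ∃[ zs ] ys ↭ xs ++ zs
⊆⇒↭ [] = [] , refl
⊆⇒↭ {xs = xs} (y ∷ʳ p) = let zs , q = ⊆⇒↭ p in
  y ∷ zs , ↭-trans (prep y q) (↭-sym (↭.shift y xs zs))
⊆⇒↭ (_∷_ {x = x} refl p) = let zs , q = ⊆⇒↭ p in zs , prep x q

⊆-++⁻ : ∀ (as : List X) {bs xs} → xs ⊆ as ++ bs →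
        ∃[ ys ] ∃[ zs ] xs ≡ ys ++ zs × ys ⊆ as × zs ⊆ bs
⊆-++⁻ []       p = [] , _ , refl , [] , p
⊆-++⁻ (a ∷ as) (.a ∷ʳ p) = let ys , zs , e , q , r = ⊆-++⁻ as p in ys , zs , e , a ∷ʳ q , r
⊆-++⁻ (a ∷ as) (refl ∷ p) =
  let ys , zs , e , q , r = ⊆-++⁻ as p in a ∷ ys , zs , cong (a ∷_) e , refl ∷ q , r

⊆-map⁻ : ∀ (f : X → Y) as {xs} → xs ⊆ map f as → ∃[ ys ] xs ≡ map f ys × ys ⊆ as
⊆-map⁻ f []       [] = [] , refl , []
⊆-map⁻ f (a ∷ as) (_ ∷ʳ p) = let ys , e , q = ⊆-map⁻ f as p in ys , e , a ∷ʳ q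
⊆-map⁻ f (a ∷ as) (refl ∷ p) =
  let ys , e , q = ⊆-map⁻ f as p in a ∷ ys , cong (f a ∷_) e , refl ∷ q

codes : ∀ d → List (Code d)
codes zero    = [] ∷ []
codes (suc d) = map (false ∷_) (codes d) ++ map (true ∷_) (codes d)

-- A set of codes, listed in lexicographic order.
data Trie : (d : ℕ) → List (Code d) → Set where
  none : Trie zero []
  one  : Trie zero ([] ∷ [])
  node : ∀ {d L M} → Trie d L → Trie d M → Trie (suc d) (map (false ∷_) L ++ map (true ∷_) M)

trie : ∀ d {L} → L ⊆ codes d → Trie d L
trie zero    (_ ∷ʳ [])   = none
trie zero    (refl ∷ []) = one
trie (suc d) p with ⊆-++⁻ (map (false ∷_) (codes d)) p
... | _ , _ , refl , q , r with ⊆-map⁻ _ (codes d) q | ⊆-map⁻ _ (codes d) r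
...   | _ , refl , q′ | _ , refl , r′ = node (trie d q′) (trie d r′)

Joined : ∀ {d} → List (Code d) → List (Code d) → List (Code (suc d))
Joined L M = map (false ∷_) L ++ map (true ∷_) M

length-joined : ∀ {d} (L M : List (Code d)) → length (Joined L M) ≡ length L + length M
length-joined L M = trans (List.length-++ (map (false ∷_) L))
  (cong₂ _+_ (List.length-map _ L) (List.length-map _ M))

size-joined : ∀ {d k} (L M : List (Code d)) → k ≤ length (Joined L M) → k ≤ length L + length M
size-joined L M = subst (_ ≤_) (length-joined L M)

size-joined-[] : ∀ {d k} (L : List (Code d)) → k ≤ length (Joined L []) → k ≤ length L
size-joined-[] L p = ℕ.≤-trans (size-joined L [] p) (ℕ.≤-reflexive (ℕ.+-identityʳ _))

size-joined-[_] : ∀ {d k} x (L : List (Code d)) → k ≤ length (Joined L (x ∷ [])) → k ≤ suc (length L)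
size-joined-[ x ] L p = ℕ.≤-trans (size-joined L (x ∷ []) p) (ℕ.≤-reflexive (ℕ.+-comm _ 1))

leaves : ∀ s → List (Leaf s)
leaves •       = tt ∷ []
leaves (s ⋆ t) = map inj₁ (leaves s) ++ map inj₂ (leaves t)

-- A sublist and not merely a subset: when `L` lists the rung labels of a comb, the leaves of `s`
-- from left to right become rungs from top to bottom.
Found : ∀ {d} → Shape → List (Code d) → Set
Found {d} s L = ∃[ e ] map (code {s} {d} e) (leaves s) ⊆ L

found-skip : ∀ {d s b} {L : List (Code d)} → Found s L → Found s (map (b ∷_) L)
found-skip {s = s} {b} (e , p) = skip b e ,
  subst (_⊆ _) (sym (List.map-∘ (leaves s))) (⊆.map⁺ (b ∷_) p)

found-fork : ∀ {d s t} {L M : List (Code d)} → Found s L → Found t M → Found (s ⋆ t) (Joined L M)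
found-fork {s = s} {t} (e , p) (f , q) = fork false e f ,
  subst (_⊆ _) (sym eq) (⊆.++⁺ (⊆.map⁺ (false ∷_) p) (⊆.map⁺ (true ∷_) q))
  where
  eq : map (code (fork false e f)) (map inj₁ (leaves s) ++ map inj₂ (leaves t))
     ≡ Joined (map (code e) (leaves s)) (map (code f) (leaves t))
  eq = trans (List.map-++ (code (fork false e f)) (map inj₁ (leaves s)) _)
    (cong₂ _++_ (trans (sym (List.map-∘ (leaves s))) (List.map-∘ (leaves s)))
                (trans (sym (List.map-∘ (leaves t))) (List.map-∘ (leaves t))))

found-left : ∀ {d s} {L : List (Code d)} M → Found s L → Found s (Joined L M)
found-left M F = let e , p = found-skip F in e , ⊆.++⁺ʳ (map (true ∷_) M) p

found-right : ∀ {d s} L {M : List (Code d)} → Found s M → Found s (Joined L M)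
found-right L F = let e , p = found-skip F in e , ⊆.++⁺ˡ (map (false ∷_) L) p

found-point : ∀ {d} {L : List (Code d)} → 1 ≤ length L → Found • L
found-point {L = x ∷ L} _ = pt x , refl ∷ ⊆.[]⊆-universal L

found-cherry : ∀ {d L} → Trie d L → 2 ≤ length L → Found (• ⋆ •) L
found-cherry one (s≤s ())
found-cherry (node {L = []}    {M}     l m) s = found-right [] (found-cherry m (size-joined [] M s))
found-cherry (node {L = L@(_ ∷ _)} {[]}    l m) s =
  found-left [] (found-cherry l (size-joined-[] L s))
found-cherry (node {L = _ ∷ _} {_ ∷ _} l m) s = found-fork (found-point (s≤s z≤n)) (found-point (s≤s z≤n))

three : Bool → Shape
three false = • ⋆ (• ⋆ •)
three true  = (• ⋆ •) ⋆ •

found-three : ∀ {d L} → Trie d L → 3 ≤ length L → ∃[ b ] Found (three b) L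
found-three one (s≤s ())
found-three (node {L = []} {M} l m) s =
  let b , F = found-three m (size-joined [] M s) in b , found-right [] F
found-three (node {L = L@(_ ∷ _)} {[]} l m) s =
  let b , F = found-three l (size-joined-[] L s)
  in b , found-left [] F
found-three (node {L = L@(_ ∷ _ ∷ _)} {_ ∷ _} l m) s =
  true , found-fork (found-cherry l (s≤s (s≤s z≤n))) (found-point (s≤s z≤n))
found-three (node {L = L@(_ ∷ [])} {M} l m) s =
  false , found-fork (found-point (s≤s z≤n)) (found-cherry m (s≤s⁻¹ (size-joined L M s)))

quartet : Shape
quartet = (• ⋆ •) ⋆ (• ⋆ •)

found-quartet : ∀ {d L} → Trie d L → d + 2 ≤ length L → Found quartet L
found-quartet none ()
found-quartet one (s≤s ())
found-quartet (node {L = []} {M} l m) s =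
  found-right [] (found-quartet m (ℕ.<⇒≤ (size-joined [] M s)))
found-quartet (node {L = L@(_ ∷ [])} {M} l m) s =
  found-right L (found-quartet m (s≤s⁻¹ (size-joined L M s)))
found-quartet (node {L = L@(_ ∷ _ ∷ _)} {[]} l m) s =
  found-left [] (found-quartet l (ℕ.<⇒≤ (size-joined-[] L s)))
found-quartet (node {L = L@(_ ∷ _ ∷ _)} {M@(_ ∷ [])} l m) s =
  found-left M (found-quartet l (s≤s⁻¹ (size-joined-[ _ ] L s)))
found-quartet (node {L = _ ∷ _ ∷ _} {_ ∷ _ ∷ _} l m) s =
  found-fork (found-cherry l (s≤s (s≤s z≤n))) (found-cherry m (s≤s (s≤s z≤n)))

data Core : Set where
  headed : Core
  split  : Bool → Core

core : Core → Shape
core headed    = • ⋆ quartet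
core (split b) = three b ⋆ (• ⋆ •)

-- Sides with at most one word are dropped as for the quartet, except a single word on the left.
-- With two words on the right, three on the left give a `split` core; otherwise the left has at
-- most two words, and the right keeps enough for a quartet.
found-core : ∀ {d L} → Trie d L → d + 4 ≤ length L → ∃[ c ] Found (core c) L
found-core none ()
found-core one (s≤s ())
found-core (node {L = []} {M} l m) s =
  let c , F = found-core m (ℕ.<⇒≤ (size-joined [] M s)) in c , found-right [] F
found-core (node {L = L@(_ ∷ _)} {[]} l m) s =
  let c , F = found-core l (ℕ.<⇒≤ (size-joined-[] L s))
  in c , found-left [] F
found-core (node {L = L@(_ ∷ _)} {M@(_ ∷ [])} l m) s =
  let c , F = found-core l (s≤s⁻¹ (size-joined-[ _ ] L s))
  in c , found-left M F
found-core {suc d} (node {L = L@(_ ∷ _)} {M@(_ ∷ _ ∷ _)} l m) s with 3 ℕ.≤? length L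
... | yes 3≤ = let b , F = found-three l 3≤ in split b , found-fork F (found-cherry m (s≤s (s≤s z≤n)))
... | no  3≰ = headed , found-fork (found-point (s≤s z≤n)) (found-quartet m
  (ℕ.+-cancelˡ-≤ 2 _ _ (ℕ.≤-trans (ℕ.≤-reflexive eq)
    (ℕ.≤-trans (ℕ.<⇒≤ s′) (ℕ.+-monoˡ-≤ (length M) (s≤s⁻¹ (ℕ.≰⇒> 3≰)))))))
  where
  s′ = size-joined L M s
  eq : 2 + (d + 2) ≡ d + 4
  eq = trans (ℕ.+-comm 2 _) (ℕ.+-assoc d 2 2)

-- Leaves (dummies) branching off above s one after the other; no quartet containing
-- a dummy is balanced.  The Boolean `false` puts a dummy before s.
wrap : ∀ {j} → Vec Bool j → Shape → Shape
wrap []           s = s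
wrap (false ∷ bs) s = • ⋆ wrap bs s
wrap (true  ∷ bs) s = wrap bs s ⋆ •

halve : ∀ j N a b → 2 ^ suc j * N ≤ a + b → 2 ^ j * N ≤ a ⊎ 2 ^ j * N ≤ b
halve j N a b p with 2 ^ j * N ℕ.≤? a
... | yes q = inj₁ q
... | no ¬q = inj₂ (ℕ.+-cancelˡ-≤ (2 ^ j * N) _ _
  (ℕ.≤-trans (ℕ.≤-reflexive eq) (ℕ.≤-trans p (ℕ.+-monoˡ-≤ b (ℕ.<⇒≤ (ℕ.≰⇒> ¬q))))))
  where
  eq : 2 ^ j * N + 2 ^ j * N ≡ 2 ^ suc j * N
  eq = trans (cong (2 ^ j * N +_) (sym (ℕ.+-identityʳ _))) (sym (ℕ.*-assoc 2 (2 ^ j) N))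

N≤2^jN : ∀ j N → N ≤ 2 ^ j * N
N≤2^jN j N = ℕ.≤-trans (ℕ.≤-reflexive (sym (ℕ.*-identityˡ N))) (ℕ.*-monoˡ-≤ N (ℕ.m^n>0 2 j))

module _ {C Λ : Set} (shape : C → Shape) (N D : ℕ) (2≤N : 2 ≤ N)
  (Other : ∀ {d} → Vec Λ d → List (Code d) → Set)
  (other-left  : ∀ {d ℓ} {ℓs : Vec Λ d} {L} M → Other ℓs L → Other (ℓ ∷ ℓs) (Joined L M))
  (other-right : ∀ {d ℓ} {ℓs : Vec Λ d} L {M} → Other ℓs M → Other (ℓ ∷ ℓs) (Joined L M))
  (base : ∀ {d L} → d ≤ D → ∀ ℓs → Trie d L → N ≤ length L → (∃[ c ] Found (shape c) L) ⊎ Other ℓs L)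
  where

  -- At each proper branching the search enters a side that keeps half of the required words, and a
  -- word of the other side becomes a dummy; after `j` branchings `N` words remain for `base`.
  -- `Other` is an alternative outcome that survives the return to larger sets.
  found-wrapped : ∀ j {d L} → d ≤ D → ∀ ℓs → Trie d L → 2 ^ j * N ≤ length L →
    (∃[ bs ] ∃[ c ] Found (wrap {j} bs (shape c)) L) ⊎ Other ℓs L
  found-wrapped zero d≤D ℓs l s with base d≤D ℓs l (subst (_≤ _) (ℕ.*-identityˡ N) s)
  ... | inj₁ (c , F) = inj₁ ([] , c , F)
  ... | inj₂ o       = inj₂ o
  found-wrapped (suc j) d≤D ℓs none s =
    contradiction (ℕ.≤-trans 2≤N (ℕ.≤-trans (N≤2^jN (suc j) N) s)) λ ()
  found-wrapped (suc j) d≤D ℓs one s =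
    contradiction (ℕ.≤-trans 2≤N (ℕ.≤-trans (N≤2^jN (suc j) N) s)) λ { (s≤s ()) }
  found-wrapped (suc j) d<D (_ ∷ ℓs) (node {L = []} {M} l m) s
    with found-wrapped (suc j) (ℕ.<⇒≤ d<D) ℓs m (size-joined [] M s)
  ... | inj₁ (bs , c , F) = inj₁ (bs , c , found-right [] F)
  ... | inj₂ o            = inj₂ (other-right [] o)
  found-wrapped (suc j) d<D (_ ∷ ℓs) (node {L = L@(_ ∷ _)} {[]} l m) s
    with found-wrapped (suc j) (ℕ.<⇒≤ d<D) ℓs l (size-joined-[] L s)
  ... | inj₁ (bs , c , F) = inj₁ (bs , c , found-left [] F)
  ... | inj₂ o            = inj₂ (other-left [] o)
  found-wrapped (suc j) d<D (_ ∷ ℓs) (node {L = L@(_ ∷ _)} {M@(_ ∷ _)} l m) s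
    with halve j N (length L) (length M) (size-joined L M s)
  ... | inj₁ p with found-wrapped j (ℕ.<⇒≤ d<D) ℓs l p
  ...   | inj₁ (bs , c , F) = inj₁ (true ∷ bs , c , found-fork F (found-point (s≤s z≤n)))
  ...   | inj₂ o            = inj₂ (other-left M o)
  found-wrapped (suc j) d<D (_ ∷ ℓs) (node {L = L@(_ ∷ _)} {M@(_ ∷ _)} l m) s | inj₂ p
    with found-wrapped j (ℕ.<⇒≤ d<D) ℓs m p
  ...   | inj₁ (bs , c , F) = inj₁ (false ∷ bs , c , found-fork (found-point (s≤s z≤n)) F)
  ...   | inj₂ o            = inj₂ (other-right L o)

-- Combs

comb : ℕ → Shape
comb zero    = •
comb (suc k) = • ⋆ comb k

pick : (xs : List X) → Node (comb (length xs)) → X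
pick (x ∷ xs) (inj₁ tt)       = x
pick (x ∷ xs) (inj₂ (inj₂ n)) = pick xs n

-- A comb in Z of which every set of rungs (labelled by L) can be extracted.
Comb : {Λ : Set} → ℕ → ∀ {d} → Vec Λ d → List (Code d) → Set
Comb {Λ} K {d} ℓs Z = ∃[ L ] K ≤ length L × L ⊆ Vec.toList ℓs ×
  (∀ {s} (f : Leaf s → Λ) xs → map f xs ⊆ L →
    ∃[ e ] (∀ n → label {d = d} e ℓs n ≡ f (pick xs n)) ×
           (∃[ R ] Z ↭ map (code e) (leaves (comb (length xs))) ++ R))

comb-bottom : ∀ {Λ : Set} {d} {ℓs : Vec Λ d} {Z : List (Code d)} → 1 ≤ length Z → Comb 0 ℓs Z
comb-bottom {ℓs = ℓs} {x ∷ Z} _ = [] , z≤n , ⊆.[]⊆-universal _ , λ where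
  f [] [] → pt x , (λ ()) , Z , refl

comb-skip : ∀ {Λ : Set} {K d ℓ} {ℓs : Vec Λ d} b {Z Z′} (R₀ : List (Code (suc d))) →
  Z′ ↭ map (b ∷_) Z ++ R₀ → Comb K ℓs Z → Comb K (ℓ ∷ ℓs) Z′
comb-skip {ℓ = ℓ} b {Z} R₀ q (L , K≤ , p , ext) = L , K≤ , ℓ ∷ʳ p , λ f xs r →
  let e , h , R , q′ = ext f xs r in skip b e , h , map (b ∷_) R ++ R₀ ,
    ↭-trans q (↭-trans (↭.++⁺ʳ R₀ (↭.map⁺ (b ∷_) q′)) (↭-reflexive (eq (length xs) e R)))
  where
  eq : ∀ k e R → map (b ∷_) (map (code e) (leaves (comb k)) ++ R) ++ R₀
     ≡ map (code (skip b e)) (leaves (comb k)) ++ map (b ∷_) R ++ R₀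
  eq k e R = trans (cong (_++ R₀) (List.map-++ (b ∷_) (map (code e) (leaves (comb k))) R))
    (trans (List.++-assoc (map (b ∷_) (map (code e) (leaves (comb k)))) (map (b ∷_) R) R₀)
      (cong (_++ (map (b ∷_) R ++ R₀)) (sym (List.map-∘ (leaves (comb k))))))

comb-fork : ∀ {Λ : Set} {K d ℓ} {ℓs : Vec Λ d} b {c Z Z′} →
  Z′ ↭ (b ∷ c) ∷ map (not b ∷_) Z → Comb K ℓs Z → Comb (suc K) (ℓ ∷ ℓs) Z′
comb-fork {ℓ = ℓ} {ℓs} b {c} {Z} {Z′} q (L , K≤ , p , ext) = ℓ ∷ L , s≤s K≤ , refl ∷ p , ext′
  where
  skipped = comb-skip {ℓ = ℓ} (not b) ((b ∷ c) ∷ [])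
    (↭-trans q (↭.∷↭∷ʳ (b ∷ c) (map (not b ∷_) Z))) (L , K≤ , p , ext)
  ext′ : ∀ {s} (f : Leaf s → _) xs → map f xs ⊆ ℓ ∷ L →
    ∃[ e ] (∀ n → label e (ℓ ∷ ℓs) n ≡ f (pick xs n)) ×
           (∃[ R ] Z′ ↭ map (code e) (leaves (comb (length xs))) ++ R)
  -- If the rung `ℓ` is not wanted, its coordinate is skipped and its tooth joins the remainder.
  ext′ f []       (_ ∷ʳ r) = proj₂ (proj₂ (proj₂ skipped)) f [] r
  ext′ f (x ∷ xs) (_ ∷ʳ r) = proj₂ (proj₂ (proj₂ skipped)) f (x ∷ xs) r
  ext′ f (x ∷ xs) (refl ∷ r) = let e , h , R , q′ = ext f xs r in
    fork b (pt c) e , (λ { (inj₁ tt) → refl ; (inj₂ (inj₂ n)) → h n }) , map (not b ∷_) R ,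
    ↭-trans q (prep (b ∷ c) (↭-trans (↭.map⁺ (not b ∷_) q′) (↭-reflexive (eq (length xs) e R))))
    where
    eq : ∀ k e R → map (not b ∷_) (map (code e) (leaves (comb k)) ++ R)
       ≡ map (code (fork b (pt c) e)) (map inj₂ (leaves (comb k))) ++ map (not b ∷_) R
    eq k e R = trans (List.map-++ (not b ∷_) (map (code e) (leaves (comb k))) R)
      (cong (_++ map (not b ∷_) R) (trans (sym (List.map-∘ (leaves (comb k))))
        (List.map-∘ (leaves (comb k)))))

comb-left : ∀ {Λ : Set} {K d ℓ} {ℓs : Vec Λ d} {L} M → Comb K ℓs L → Comb K (ℓ ∷ ℓs) (Joined L M)
comb-left M = comb-skip false (map (true ∷_) M) refl

comb-right : ∀ {Λ : Set} {K d ℓ} {ℓs : Vec Λ d} L {M} → Comb K ℓs M → Comb K (ℓ ∷ ℓs) (Joined L M)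
comb-right L {M} = comb-skip true (map (false ∷_) L) (↭.++-comm (map (false ∷_) L) (map (true ∷_) M))

-- If no branching has two words on both sides, each one splits off a single word, which becomes a
-- tooth; the last of the `suc K` words is the bottom of the comb.
quartet-or-comb : ∀ {Λ : Set} K {d Z} (ℓs : Vec Λ d) → Trie d Z → suc K ≤ length Z →
                  Found quartet Z ⊎ Comb K ℓs Z
quartet-or-comb zero    ℓs z s = inj₂ (comb-bottom s)
quartet-or-comb (suc K) ℓs one (s≤s ())
quartet-or-comb (suc K) (ℓ ∷ ℓs) (node {L = []} {M} l m) s
  with quartet-or-comb (suc K) ℓs m (size-joined [] M s)
... | inj₁ F = inj₁ (found-right [] F)
... | inj₂ o = inj₂ (comb-right [] o)
quartet-or-comb (suc K) (ℓ ∷ ℓs) (node {L = L@(_ ∷ [])} {M} l m) s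
  with quartet-or-comb K ℓs m (s≤s⁻¹ (size-joined L M s))
... | inj₁ F = inj₁ (found-right L F)
... | inj₂ o = inj₂ (comb-fork false refl o)
quartet-or-comb (suc K) (ℓ ∷ ℓs) (node {L = L@(_ ∷ _ ∷ _)} {[]} l m) s
  with quartet-or-comb (suc K) ℓs l (size-joined-[] L s)
... | inj₁ F = inj₁ (found-left [] F)
... | inj₂ o = inj₂ (comb-left [] o)
quartet-or-comb (suc K) (ℓ ∷ ℓs) (node {L = L@(_ ∷ _ ∷ _)} {M@(y ∷ [])} l m) s
  with quartet-or-comb K ℓs l (s≤s⁻¹ (size-joined-[ y ] L s))
... | inj₁ F = inj₁ (found-left M F)
... | inj₂ o = inj₂ (comb-fork true (↭-sym (↭.∷↭∷ʳ (true ∷ y) (map (false ∷_) L))) o)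
quartet-or-comb (suc K) (ℓ ∷ ℓs) (node {L = _ ∷ _ ∷ _} {_ ∷ _ ∷ _} l m) s =
  inj₁ (found-fork (found-cherry l (s≤s (s≤s z≤n))) (found-cherry m (s≤s (s≤s z≤n))))

-- Pairings with an odd number of good transversals

nth : X → List X → ℕ → X
nth z []       _       = z
nth z (x ∷ xs) zero    = x
nth z (x ∷ xs) (suc i) = nth z xs i

map-nth : ∀ (z : X) xs → map (nth z xs) (upTo (length xs)) ≡ xs
map-nth z []       = refl
map-nth z (x ∷ xs) = cong (x ∷_) (trans (List.map-applyUpTo suc (nth z (x ∷ xs)) (length xs))
  (trans (sym (List.map-applyUpTo id (nth z xs) (length xs))) (map-nth z xs)))

-- A default for ranks out of range, which the check in `odd-pairing` excludes.
first-leaf : ∀ s → Leaf s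
first-leaf •       = tt
first-leaf (s ⋆ t) = inj₁ (first-leaf s)

nth-leaf : ∀ s → ℕ → Leaf s
nth-leaf s = nth (first-leaf s) (leaves s)

map-pairs : (X → Y) → List (X × X) → List (Y × Y)
map-pairs f = map λ (x , y) → f x , f y

entries-map : ∀ (f : X → Y) ps → entries (map-pairs f ps) ≡ map f (entries ps)
entries-map f []             = refl
entries-map f ((x , y) ∷ ps) = cong (λ zs → f x ∷ f y ∷ zs) (entries-map f ps)

-- The pairing ps of the leaves of s, given by their ranks, has an odd number of
-- transversals on which g holds.
odd-pairing : ∀ s → (List (Leaf s) → Bool) → List (ℕ × ℕ) → Bool
odd-pairing s g ps = dsum (map-pairs (nth-leaf s) ps) g
  ∧ does (List.≡-dec ℕ._≟_ (sort (entries ps)) (upTo (length (leaves s))))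

Config : ∀ {d} → List (Code d) → ℕ → (List (Code d) → Bool) → Set
Config Z k f = ∃[ ps ] ∃[ R ] Z ↭ entries ps ++ R × length ps ≡ k × dsum ps f ≡ true

-- Carries a finite check on a shape over to embedded words. The comparison of the sorted ranks
-- guarantees that the pairing uses every leaf exactly once.
odd-pairing⇒config : ∀ {s d} (e : Emb s d) {g f} → (∀ S → f (map (code e) S) ≡ g S) →
  ∀ ps → odd-pairing s g ps ≡ true →
  ∀ {Z R} → Z ↭ map (code e) (leaves s) ++ R → Config Z (length ps) f
odd-pairing⇒config {s} e {g} {f} fg ps odd {Z} {R} q
  with dsum (map-pairs (nth-leaf s) ps) g in d
     | List.≡-dec ℕ._≟_ (sort (entries ps)) (upTo (length (leaves s))) | odd
... | true | yes sorted | _ =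
  map-pairs (code e) qs , R ,
  ↭-trans q (↭.++⁺ʳ R (↭-trans (↭.map⁺ (code e) (↭-sym perm)) (↭-reflexive (sym (entries-map (code e) qs))))) ,
  trans (List.length-map _ qs) (List.length-map _ ps) ,
  trans (dsum-map (code e) qs f) (trans (dsum-cong qs fg) d)
  where
  qs = map-pairs (nth-leaf s) ps
  perm : entries qs ↭ leaves s
  perm = ↭-trans (↭-reflexive (entries-map (nth-leaf s) ps))
    (↭-trans (↭.map⁺ (nth-leaf s) (↭-trans (↭-sym (sort-↭ (entries ps))) (↭-reflexive sorted)))
      (↭-reflexive (map-nth (first-leaf s) (leaves s))))

-- The ranks, starting from lo, of the dummies among the leaves of `wrap bs s`, for a
-- core s with k leaves.
dummies : ∀ {j} → Vec Bool j → ℕ → ℕ → Vec ℕ j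
dummies []                 lo k = []
dummies (false ∷ bs)       lo k = lo ∷ dummies bs (suc lo) k
dummies {suc j} (true ∷ bs) lo k = (lo + j + k) ∷ dummies bs lo k

core-start : ∀ {j} → Vec Bool j → ℕ
core-start []           = 0
core-start (false ∷ bs) = suc (core-start bs)
core-start (true  ∷ bs) = core-start bs

-- The core itself is the only balanced transversal, so any matching of the dummies with the core
-- would do.
quartet-pairing : Vec Bool 4 → List (ℕ × ℕ)
quartet-pairing bs with dummies bs 0 4 | core-start bs
... | e₁ ∷ e₂ ∷ e₃ ∷ e₄ ∷ [] | lo =
  (e₁ , lo) ∷ (e₂ , 1 + lo) ∷ (e₃ , 2 + lo) ∷ (e₄ , 3 + lo) ∷ []

-- Puts two dummies on the same side of the core first: with a `split` core their
-- contributions to `comb-pairing` cancel only if they are equal.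
arrange : Vec Bool 4 → Vec ℕ 4 → Vec ℕ 4
arrange (b₁ ∷ b₂ ∷ b₃ ∷ _) (e₁ ∷ e₂ ∷ e₃ ∷ e₄ ∷ []) =
  if not (b₁ xor b₂) then e₁ ∷ e₂ ∷ e₃ ∷ e₄ ∷ []
  else if not (b₁ xor b₃) then e₁ ∷ e₃ ∷ e₂ ∷ e₄ ∷ []
  else e₂ ∷ e₃ ∷ e₁ ∷ e₄ ∷ []

-- Rank 9 is the bottom of the comb.  A transversal containing it has the remaining four
-- leaves as branchings; the other transversals lose their last leaf, and an even number
-- of them is balanced.
comb-pairing : Vec Bool 4 → List (ℕ × ℕ)
comb-pairing bs with arrange bs (dummies bs 0 5) | core-start bs
... | e₁ ∷ e₂ ∷ e₃ ∷ e₄ ∷ [] | lo =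
  (9 , lo) ∷ (e₁ , 1 + lo) ∷ (e₂ , 2 + lo) ∷ (e₃ , 3 + lo) ∷ (e₄ , 4 + lo) ∷ []

every : ∀ n → (Vec Bool n → Bool) → Bool
every zero    f = f []
every (suc n) f = every n (f ∘ (true ∷_)) ∧ every n (f ∘ (false ∷_))

every-sound : ∀ n f → every n f ≡ true → ∀ bs → f bs ≡ true
every-sound zero    f e [] = e
every-sound (suc n) f e (b ∷ bs) with every n (f ∘ (true ∷_)) in p | e
every-sound (suc n) f e (true  ∷ bs) | true | _ = every-sound n _ p bs
every-sound (suc n) f e (false ∷ bs) | true | q = every-sound n _ q bs

-- Evaluation of the sixteen placements of the dummies.
quartet-odd : ∀ bs → odd-pairing (wrap bs quartet) (balancedₛ _) (quartet-pairing bs) ≡ true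
quartet-odd = every-sound 4 _ refl

-- The property behind the second bit, on a comb whose rungs are labelled from the top by the leaves
-- of `s`. Leaves of a comb branch at the rungs of all of them but the lowest.
balanced-rungs : ∀ s → List (Leaf (comb (length (leaves s)))) → Bool
balanced-rungs s S = balancedₛ s (map (pick (leaves s)) (branchingsₛ (comb (length (leaves s))) S))

core-odd? : Core → Vec Bool 4 → Bool
core-odd? c bs = odd-pairing _ (balanced-rungs (wrap bs (core c))) (comb-pairing bs)

core-odd : ∀ bs c → core-odd? c bs ≡ true
core-odd bs c = every-sound 4 (core-odd? c) (holds c) bs
  where
  holds : ∀ c → every 4 (core-odd? c) ≡ true
  holds headed        = refl
  holds (split true)  = refl
  holds (split false) = refl

quartet-pairing-length : ∀ bs → length (quartet-pairing bs) ≡ 4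
quartet-pairing-length bs with dummies bs 0 4
... | _ ∷ _ ∷ _ ∷ _ ∷ [] = refl

comb-pairing-length : ∀ bs → length (comb-pairing bs) ≡ 5
comb-pairing-length bs with arrange bs (dummies bs 0 5)
... | _ ∷ _ ∷ _ ∷ _ ∷ [] = refl

balanced-branchings : ∀ {d h} (ℓs : Vec (Code h) d) → List (Code d) → Bool
balanced-branchings ℓs = balanced ∘ branchings ℓs

balanced-branchings-↭ : ∀ {d h} (ℓs : Vec (Code h) d) → Symmetric (balanced-branchings ℓs)
balanced-branchings-↭ ℓs p = cong balanced (branchings-↭ ℓs p)

-- The rung labels are themselves words, of length `h`, and numerous enough to contain a core with
-- four dummies. The comb is thinned out to the nine rungs with these labels.
comb-config : ∀ {h m Z} (ℓs : Vec (Code h) m) → Vec.toList ℓs ⊆ codes h →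
  Comb (2 ^ 4 * (h + 4)) ℓs Z → Config Z 5 (balanced-branchings ℓs)
comb-config {h} {m} {Z} ℓs ℓs⊆ (L , K≤ , L⊆ , ext) with
  found-wrapped core (h + 4) h (ℕ.m≤n⇒m≤o+n h (s≤s (s≤s z≤n))) (λ _ _ → ⊥) (λ _ → id) (λ _ → id)
    (λ d≤h _ l s → inj₁ (found-core l (ℕ.≤-trans (ℕ.+-monoˡ-≤ 4 d≤h) s)))
    4 ℕ.≤-refl (Vec.replicate h tt) (trie h (⊆-trans L⊆ ℓs⊆)) K≤
... | inj₁ (bs , c , e₂ , p) with ext (code e₂) (leaves (wrap bs (core c))) p
...   | e₁ , rung , R , q = subst (λ k → Config Z k (balanced-branchings ℓs)) (comb-pairing-length bs)
  (odd-pairing⇒config e₁ agree (comb-pairing bs) (core-odd bs c) q)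
  where
  s = wrap bs (core c)
  agree : ∀ S → balanced-branchings ℓs (map (code e₁) S) ≡ balanced-rungs s S
  agree S = trans (balanced-↭ (branchings-code e₁ ℓs S))
    (trans (cong balanced (trans (List.map-cong rung B) (List.map-∘ B)))
      (balanced-code e₂ (map (pick (leaves s)) B)))
    where B = branchingsₛ (comb (length (leaves s))) S

-- The inner number of words forces a quartet or a comb with `2 ^ 4 * (h + 4)` rungs, as
-- `comb-config` demands; the outer factor `2 ^ 4` pays for the four dummies of the quartet.
config : ∀ {h m Z} (ℓs : Vec (Code h) m) → Vec.toList ℓs ⊆ codes h → Z ⊆ codes m →
  2 ^ 4 * suc (2 ^ 4 * (h + 4)) ≤ length Z →
  Config Z 4 balanced ⊎ Config Z 5 (balanced-branchings ℓs)
config {h} {m} {Z} ℓs ℓs⊆ Z⊆ s with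
  found-wrapped (λ (_ : ⊤) → quartet) (suc K) m (s≤s (ℕ.≤-trans (ℕ.m≤n⇒m≤o+n h (s≤s z≤n)) (N≤2^jN 4 (h + 4))))
    (Comb K) comb-left comb-right
    (λ _ ℓs z s → Sum.map₁ (tt ,_) (quartet-or-comb K ℓs z s))
    4 ℕ.≤-refl ℓs (trie m Z⊆) s
  where
  K = 2 ^ 4 * (h + 4)
... | inj₂ o = inj₂ (comb-config ℓs ℓs⊆ o)
... | inj₁ (bs , _ , e , p) with ⊆⇒↭ p
...   | R , q = inj₁ (subst (λ k → Config Z k balanced) (quartet-pairing-length bs)
  (odd-pairing⇒config e (balanced-code e) (quartet-pairing bs) (quartet-odd bs) q))

-- Classes that meet few layers

module _ {g} .{{_ : NonZero g}} where

  same-residue : ∀ {m n} → m ≤ n → m % g ≡ n % g → ∃[ k ] n ≡ m + k * g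
  same-residue {m} {n} m≤n e = n / g ∸ m / g , (begin-equality
    n                                               ≡⟨ ℕ.m≡m%n+[m/n]*n n g ⟩
    n % g + n / g * g                               ≡⟨ cong₂ _+_ (sym e) (cong (_* g) (sym quotients)) ⟩
    m % g + (m / g + (n / g ∸ m / g)) * g           ≡⟨ cong (m % g +_) (ℕ.*-distribʳ-+ g (m / g) _) ⟩
    m % g + (m / g * g + (n / g ∸ m / g) * g)       ≡⟨ ℕ.+-assoc (m % g) _ _ ⟨
    m % g + m / g * g + (n / g ∸ m / g) * g         ≡⟨ cong (_+ (n / g ∸ m / g) * g) (ℕ.m≡m%n+[m/n]*n m g) ⟨
    m + (n / g ∸ m / g) * g                         ∎)
    where
    open ℕ.≤-Reasoning
    quotients : m / g + (n / g ∸ m / g) ≡ n / g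
    quotients = ℕ.m+[n∸m]≡n (ℕ./-monoˡ-≤ g m≤n)

  residue-gap : ∀ {a x} → a < x → x < a + g → x % g ≢ a % g
  residue-gap {a} {x} a<x x<a+g e with same-residue (ℕ.<⇒≤ a<x) (sym e)
  ... | zero  , refl = ℕ.<-irrefl (sym (ℕ.+-identityʳ a)) a<x
  ... | suc k , refl = contradiction x<a+g (ℕ.≤⇒≯ (ℕ.+-monoʳ-≤ a (ℕ.m≤m+n g (k * g))))

⊑⇒between : ∀ {n} {M : Subset n → Set} {u w v : Subset n} → u ⊑ w → w ⊑ v → Between {M = M} u w v
⊑⇒between {u = u} {w} {v} p q i with lookup u i in eu | lookup w i in ew | lookup v i in ev
... | false | false | _     = inj₁ refl
... | false | true  | true  = inj₂ refl
... | true  | true  | _     = inj₁ refl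
... | false | true  | false = contradiction (trans (sym ev) (at q i ew)) λ ()
... | true  | false | _     = contradiction (trans (sym ew) (at p i eu)) λ ()

flip : ∀ {n} {M : Subset n → Set} {u v : Subset n} i {b} → lookup v i ≡ b → lookup u i ≢ b →
       u [ i ]≔ b ≡ v ⊎ ¬ M (u [ i ]≔ b) → Route M (u [ i ]≔ b) v → Route M u v
flip i refl d a r = move i d a r

-- M meets only every g-th layer, and it can be avoided when crossing one of these.
module Sparse {n} (M : Subset n → Set) (g : ℕ) .{{_ : NonZero g}} (3≤g : 3 ≤ g) (r : ℕ)
  (layers : ∀ {x} → M x → ∣ x ∣ % g ≡ r)
  (cross : ∀ a {w y} → w ⊑ y → a ≤ ∣ w ∣ → ∣ w ∣ ≤ suc a → ∣ y ∣ ≡ a + 2 * g →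
           ∃[ x ] w ⊑ x × x ⊑ y × ∣ x ∣ ≡ a + g × ¬ M x)
  where

  gap : ∀ {a x} → a % g ≡ r → a < ∣ x ∣ → ∣ x ∣ < a + g → ¬ M x
  gap a≡r p q m = residue-gap p q (trans (layers m) (sym a≡r))

  climb : ∀ k {w v} → w ⊑ v → ∣ v ∣ ≡ ∣ w ∣ + k →
          (∀ {x} → ∣ w ∣ < ∣ x ∣ → ∣ x ∣ < ∣ v ∣ → ¬ M x) → Route M w v
  climb zero {w} {v} p e free =
    subst (Route M w) (⊑-size p (ℕ.≤-reflexive (trans e (ℕ.+-identityʳ _)))) stay
  climb (suc k) {w} {v} p e free
    with missing w v (ℕ.<-≤-trans (ℕ.m<m+n _ (s≤s z≤n)) (ℕ.≤-reflexive (sym e)))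
  ... | i , wi , vi = flip i vi (λ wi′ → contradiction (trans (sym wi) wi′) λ ()) ok
    (climb k p′ e′ λ q → free (ℕ.<-trans (ℕ.≤-reflexive (sym size)) q))
    where
    p′ = insert-⊑ p vi
    size = ∣insert∣ w i wi
    e′ : ∣ v ∣ ≡ ∣ w [ i ]≔ true ∣ + k
    e′ = trans e (trans (ℕ.+-suc _ k) (cong (_+ k) (sym size)))
    ok : w [ i ]≔ true ≡ v ⊎ ¬ M (w [ i ]≔ true)
    ok with ∣ w [ i ]≔ true ∣ ℕ.<? ∣ v ∣
    ... | yes q = inj₂ (free (ℕ.≤-reflexive (sym size)) q)
    ... | no ¬q = inj₁ (⊑-size p′ (ℕ.≮⇒≥ ¬q))

  below : ∀ {a x} → x ≤ suc a → x ≤ a + 2 * g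
  below {a} h = ℕ.≤-trans h (ℕ.≤-trans (ℕ.≤-reflexive (ℕ.+-comm 1 a))
    (ℕ.+-monoʳ-≤ a (ℕ.≤-trans (ℕ.≤-trans (s≤s z≤n) 3≤g) (ℕ.m≤m+n g _))))

  -- To pass the layer `a + g`, an intermediate `y` is chosen on the layer `a + 2 * g`, and `cross`
  -- gives `x` below it. The next round starts at `x`, on the layer `a + g` itself, whereas `zigzag`
  -- starts one layer above; hence the two bounds on the size of `w`.
  up : ∀ k a {w v} → a % g ≡ r → w ⊑ v → a ≤ ∣ w ∣ → ∣ w ∣ ≤ suc a → ∣ v ∣ ≡ a + suc k * g → Route M w v
  up zero a {w} {v} a≡r p l h e = climb (∣ v ∣ ∸ ∣ w ∣) p (sym (ℕ.m+[n∸m]≡n (∣∣-mono p)))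
    λ q q′ → gap a≡r (ℕ.≤-<-trans l q)
      (ℕ.<-≤-trans q′ (ℕ.≤-reflexive (trans e (cong (a +_) (ℕ.*-identityˡ g)))))
  up (suc k) a {w} {v} a≡r p l h e with between (a + 2 * g ∸ ∣ w ∣) p
    (ℕ.≤-trans (ℕ.≤-reflexive (ℕ.m+[n∸m]≡n (below h)))
      (ℕ.≤-trans (ℕ.+-monoʳ-≤ a (ℕ.*-monoˡ-≤ g (s≤s (s≤s (z≤n {k}))))) (ℕ.≤-reflexive (sym e))))
  ... | y , w⊑y , y⊑v , ey with cross a w⊑y l h (trans ey (ℕ.m+[n∸m]≡n (below h)))
  ...   | x , w⊑x , x⊑y , ex , ¬Mx = route-trans (⊑⇒between {M = M} w⊑x (⊑-trans x⊑y y⊑v)) (inj₂ ¬Mx)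
    (climb (∣ x ∣ ∸ ∣ w ∣) w⊑x (sym (ℕ.m+[n∸m]≡n (∣∣-mono w⊑x)))
      (λ q q′ → gap a≡r (ℕ.≤-<-trans l q) (ℕ.<-≤-trans q′ (ℕ.≤-reflexive ex))))
    (up k (a + g) (trans (ℕ.[m+n]%n≡m%n a g) a≡r) (⊑-trans x⊑y y⊑v)
      (ℕ.≤-reflexive (sym ex)) (ℕ.m≤n⇒m≤1+n (ℕ.≤-reflexive ex)) (trans e (sym (ℕ.+-assoc a g _))))

  -- Inserting an element of `v` and then deleting one outside `v` visits the layers `a + 2` and
  -- `a + 1`, free of `M` as `3 ≤ g`. When nothing is left to delete, the route climbs; when nothing
  -- is left to insert, sizes force `k` to be `0` and a single deletion reaches `v`. The fuel bounds
  -- the distance.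
  zigzag : ∀ fuel k a {w v} → a % g ≡ r → ∣ w ∣ ≡ suc a → ∣ v ∣ ≡ a + k * g → dist w v ≤ fuel → Route M w v
  zigzag zero k a {w} {v} a≡r ew ev d = subst (Route M w) (dist≡0 w v (ℕ.n≤0⇒n≡0 d)) stay
  zigzag (suc fuel) k a {w} {v} a≡r ew ev d with missing? v w
  zigzag (suc fuel) zero a {w} {v} a≡r ew ev d | inj₂ w⊑v =
    contradiction (∣∣-mono w⊑v) (ℕ.<⇒≱ (ℕ.≤-reflexive (trans (cong suc (trans ev (ℕ.+-identityʳ a))) (sym ew))))
  zigzag (suc fuel) (suc k) a {w} {v} a≡r ew ev d | inj₂ w⊑v =
    up k a a≡r w⊑v (ℕ.≤-trans (ℕ.n≤1+n a) (ℕ.≤-reflexive (sym ew))) (ℕ.≤-reflexive ew) ev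
  ... | inj₁ (i , vi , wi) with missing? w v
  zigzag (suc fuel) zero a {w} {v} a≡r ew ev d | inj₁ (i , vi , wi) | inj₂ v⊑w =
    flip i vi (λ wi′ → contradiction (trans (sym wi) wi′) λ ()) (inj₁ (sym eq)) (subst (λ x → Route M x v) eq stay)
    where
    v⊑w′ : v ⊑ (w [ i ]≔ false)
    v⊑w′ .at j vj with lookup-update w i false j
    ... | inj₁ (refl , _) = contradiction (trans (sym vi) vj) λ ()
    ... | inj₂ q          = trans q (at v⊑w j vj)
    eq : v ≡ w [ i ]≔ false
    eq = ⊑-size v⊑w′ (ℕ.≤-reflexive (trans (ℕ.suc-injective (trans (∣delete∣ w i wi) ew))
      (sym (trans ev (ℕ.+-identityʳ a)))))
  zigzag (suc fuel) (suc k) a {w} {v} a≡r ew ev d | inj₁ (i , vi , wi) | inj₂ v⊑w =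
    contradiction (∣∣-mono v⊑w) (ℕ.<⇒≱ (ℕ.≤-trans (s≤s (ℕ.≤-reflexive ew))
      (ℕ.≤-trans (ℕ.≤-trans (ℕ.≤-reflexive (ℕ.+-comm 2 a))
        (ℕ.+-monoʳ-≤ a (ℕ.≤-trans (ℕ.≤-trans (s≤s (s≤s z≤n)) 3≤g) (ℕ.m≤m+n g _))))
        (ℕ.≤-reflexive (sym ev)))))
  ... | inj₁ (j , wj , vj) =
    flip j vj (λ wj′ → contradiction (trans (sym wj) wj′) λ ())
      (inj₂ (gap a≡r (ℕ.≤-trans (ℕ.n≤1+n _) (ℕ.≤-reflexive (sym e₁))) (ℕ.≤-<-trans (ℕ.≤-reflexive e₁) (a+ 3≤g))))
      (flip i vi (λ w₁i′ → contradiction (trans (sym w₁i) w₁i′) λ ())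
        (inj₂ (gap a≡r (ℕ.≤-reflexive (sym e₂)) (ℕ.≤-<-trans (ℕ.≤-reflexive e₂) (a+ (ℕ.≤-trans (ℕ.n≤1+n 2) 3≤g)))))
        (zigzag fuel k a a≡r e₂ ev (ℕ.<⇒≤ (s≤s⁻¹ (subst (_≤ suc fuel) (sym d₂) d)))))
    where
    w₁ = w [ j ]≔ true
    w₂ = w₁ [ i ]≔ false
    a+ : ∀ {x} → x < g → x + a < a + g
    a+ {x} x<g = ℕ.<-≤-trans (s≤s (ℕ.≤-reflexive (ℕ.+-comm x a))) (ℕ.+-monoʳ-< a x<g)
    w₁i : lookup w₁ i ≡ true
    w₁i with lookup-update w j true i
    ... | inj₁ (_ , q) = q
    ... | inj₂ q       = trans q wi
    e₁ : ∣ w₁ ∣ ≡ 2 + a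
    e₁ = trans (∣insert∣ w j wj) (cong suc ew)
    e₂ : ∣ w₂ ∣ ≡ 1 + a
    e₂ = ℕ.suc-injective (trans (∣delete∣ w₁ i w₁i) e₁)
    d₂ : suc (suc (dist w₂ v)) ≡ dist w v
    d₂ = trans (cong suc (flip-dist w₁ i vi (λ q → contradiction (trans (sym w₁i) q) λ ())))
               (flip-dist w j vj (λ q → contradiction (trans (sym wj) q) λ ()))
      where
      flip-dist : ∀ u i {b} → lookup v i ≡ b → lookup u i ≢ b → suc (dist (u [ i ]≔ b) v) ≡ dist u v
      flip-dist u i refl p = dist-flip u v i p

  -- An insertion comes first, in order to leave the layer of `u` for the next one, where the
  -- exchanges of `zigzag` begin.
  ordered-route : ∀ {u v} → M u → M v → ∣ u ∣ ≤ ∣ v ∣ → Route M u v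
  ordered-route {u} {v} Mu Mv u≤v with missing? u v
  ... | inj₂ v⊑u = subst (Route M u) (sym (⊑-size v⊑u u≤v)) stay
  ... | inj₁ (j , uj , vj) with same-residue u≤v (trans (layers Mu) (sym (layers Mv)))
  ...   | k , ev = flip j vj (λ uj′ → contradiction (trans (sym uj) uj′) λ ())
    (inj₂ (gap (layers Mu) (ℕ.≤-reflexive (sym e₁)) (ℕ.≤-<-trans (ℕ.≤-reflexive e₁)
      (ℕ.≤-<-trans (ℕ.≤-reflexive (ℕ.+-comm 1 _)) (ℕ.+-monoʳ-< ∣ u ∣ (ℕ.≤-trans (s≤s (s≤s z≤n)) 3≤g))))))
    (zigzag _ k ∣ u ∣ (layers Mu) e₁ ev ℕ.≤-refl)
    where e₁ = ∣insert∣ u j uj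

  mutually-visible : IsMutualVisibilitySet (Q n) M
  mutually-visible u v Mu Mv with ℕ.≤-total ∣ u ∣ ∣ v ∣
  ... | inj₁ p = route⇒visible (ordered-route Mu Mv p)
  ... | inj₂ p = route⇒visible (route-sym (ordered-route Mv Mu p))

-- The colouring

select : ∀ {n} → Subset n → Vec X n → List X
select []          []       = []
select (true  ∷ A) (x ∷ xs) = x ∷ select A xs
select (false ∷ A) (x ∷ xs) = select A xs

select-⊆ : ∀ {n} (A : Subset n) (xs : Vec X n) → select A xs ⊆ Vec.toList xs
select-⊆ []          []       = []
select-⊆ (true  ∷ A) (x ∷ xs) = refl ∷ select-⊆ A xs
select-⊆ (false ∷ A) (x ∷ xs) = x ∷ʳ select-⊆ A xs

length-select : ∀ {n} (A : Subset n) (xs : Vec X n) → length (select A xs) ≡ ∣ A ∣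
length-select []          []       = refl
length-select (true  ∷ A) (x ∷ xs) = cong suc (length-select A xs)
length-select (false ∷ A) (x ∷ xs) = length-select A xs

select-insert : ∀ {n} (A : Subset n) (xs : Vec X n) i → lookup A i ≡ false →
                select (A [ i ]≔ true) xs ↭ lookup xs i ∷ select A xs
select-insert (false ∷ A) (x ∷ xs) zero    p = refl
select-insert (true  ∷ A) (x ∷ xs) (suc i) p = ↭-trans (prep x (select-insert A xs i p)) (swap x _ refl)
select-insert (false ∷ A) (x ∷ xs) (suc i) p = select-insert A xs i p

select-delete : ∀ {n} (A : Subset n) (xs : Vec X n) i → lookup A i ≡ true →
                select A xs ↭ lookup xs i ∷ select (A [ i ]≔ false) xs
select-delete (true  ∷ A) (x ∷ xs) zero    p = refl
select-delete (true  ∷ A) (x ∷ xs) (suc i) p = ↭-trans (prep x (select-delete A xs i p)) (swap x _ refl)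
select-delete (false ∷ A) (x ∷ xs) (suc i) p = select-delete A xs i p

∈-select : ∀ {n} (A : Subset n) (xs : Vec X n) {x} → x ∈ select A xs →
           ∃[ i ] lookup A i ≡ true × lookup xs i ≡ x
∈-select []          []       ()
∈-select (true  ∷ A) (x ∷ xs) (here refl) = zero , refl , refl
∈-select (true  ∷ A) (x ∷ xs) (there q)   = let i , p = ∈-select A xs q in suc i , p
∈-select (false ∷ A) (x ∷ xs) q           = let i , p = ∈-select A xs q in suc i , p

infixl 6 _∖_
_∖_ : ∀ {n} → Subset n → Subset n → Subset n
[]      ∖ []      = []
(a ∷ A) ∖ (b ∷ B) = (a ∧ not b) ∷ (A ∖ B)

∖-lookup : ∀ {n} (A B : Subset n) i → lookup (A ∖ B) i ≡ true → lookup A i ≡ true × lookup B i ≡ false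
∖-lookup (true ∷ A) (false ∷ B) zero    p = refl , refl
∖-lookup (a ∷ A)    (b ∷ B)     (suc i) p = ∖-lookup A B i p

∣∖∣ : ∀ {n} {A B : Subset n} → B ⊑ A → ∣ B ∣ + ∣ A ∖ B ∣ ≡ ∣ A ∣
∣∖∣ {A = []}        {[]}        p = refl
∣∖∣ {A = true  ∷ A} {true  ∷ B} p = cong suc (∣∖∣ (⊑-tail p))
∣∖∣ {A = true  ∷ A} {false ∷ B} p = trans (ℕ.+-suc _ _) (cong suc (∣∖∣ (⊑-tail p)))
∣∖∣ {A = false ∷ A} {true  ∷ B} p = contradiction (at p zero refl) λ ()
∣∖∣ {A = false ∷ A} {false ∷ B} p = ∣∖∣ (⊑-tail p)

-- The words of `S` are moved one by one from `D` into `u`; deleting each from `D` ensures that no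
-- position is used twice.
realise : ∀ {n} (xs : Vec X n) S {R} (u D : Subset n) → (∀ i → lookup D i ≡ true → lookup u i ≡ false) →
  select D xs ↭ S ++ R →
  ∃[ w ] u ⊑ w × (∀ i → lookup w i ≡ true → lookup u i ≡ true ⊎ lookup D i ≡ true)
         × select w xs ↭ S ++ select u xs
realise xs [] u D disjoint q = u , ⊑-refl , (λ i → inj₁) , refl
realise xs (s ∷ S) u D disjoint q with ∈-select D xs (↭.∈-resp-↭ (↭-sym q) (here refl))
... | i , Di , refl with realise xs S (u [ i ]≔ true) (D [ i ]≔ false) disjoint′
        (↭.drop-∷ (↭-trans (↭-sym (select-delete D xs i Di)) q))
  where
  disjoint′ : ∀ j → lookup (D [ i ]≔ false) j ≡ true → lookup (u [ i ]≔ true) j ≡ false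
  disjoint′ j Dj with lookup-update D i false j | lookup-update u i true j
  ... | inj₁ (_ , q) | _ = contradiction (trans (sym q) Dj) λ ()
  ... | inj₂ q | inj₁ (refl , _) = contradiction (trans (sym (lookup-updated D i false)) Dj) λ ()
  ... | inj₂ q | inj₂ q′ = trans q′ (disjoint j (trans (sym q) Dj))
...   | w , u⊑w , w⊑ , eq = w , ⊑-trans (⊑-insert u i) u⊑w , w⊑′ ,
        ↭-trans eq (↭-trans (↭.++⁺ˡ S (select-insert u xs i (disjoint i Di))) (↭.shift _ S _))
  where
  w⊑′ : ∀ j → lookup w j ≡ true → lookup u j ≡ true ⊎ lookup D j ≡ true
  w⊑′ j wj with w⊑ j wj
  w⊑′ j wj | inj₁ p with lookup-update u i true j
  ... | inj₁ (refl , _) = inj₂ Di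
  ... | inj₂ q          = inj₁ (trans (sym q) p)
  w⊑′ j wj | inj₂ p with lookup-update D i false j
  ... | inj₁ (refl , q) = contradiction (trans (sym q) p) λ ()
  ... | inj₂ q          = inj₂ (trans (sym q) p)

length-entries : ∀ (ps : List (X × X)) → length (entries ps) ≡ length ps + length ps
length-entries []       = refl
length-entries (_ ∷ ps) = cong suc (trans (cong suc (length-entries ps)) (sym (ℕ.+-suc _ _)))

-- Only the transversal `S` varies; `u` and a padding of `t ∸ suc k` unpaired words stay fixed. By
-- `dsum-parity` the fixed part does not affect the sum, which is odd, so some `S` avoids the value
-- `c`. The bounds on `t` leave room for `S` and for the padding.
config-crossing : ∀ {n d} (xs : Vec (Code d) n) {k g} → Symmetric g → ∀ {u y : Subset n} → u ⊑ y →
  Config (select (y ∖ u) xs) (suc k) g → ∀ t → suc k ≤ t → t + suc k ≤ ∣ y ∖ u ∣ → ∀ c →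
  ∃[ w ] u ⊑ w × w ⊑ y × ∣ w ∣ ≡ ∣ u ∣ + t × parity (suc k) g (select w xs) ≢ c
config-crossing xs {k} {g} sym-g {u} {y} u⊑y (p ∷ ps , R , q , refl , odd) t k<t t+k≤ c
  with dsum-nonconstant p ps (λ S → parity (suc k) g (S ++ (take (t ∸ suc k) R ++ select u xs)))
         (trans (dsum-parity (p ∷ ps) g _) odd) c
... | S , T , tr , ne with realise xs (S ++ take (t ∸ suc k) R) {T ++ drop (t ∸ suc k) R} u (y ∖ u)
        (λ i → proj₂ ∘ ∖-lookup y u i) (↭-trans q rearrange)
  where
  F = take (t ∸ suc k) R
  rearrange : entries (p ∷ ps) ++ R ↭ (S ++ F) ++ (T ++ drop (t ∸ suc k) R)
  rearrange = ↭-trans (↭.++⁺ (↭-sym (transversal-↭ tr)) (↭-reflexive (sym (List.take++drop≡id (t ∸ suc k) R))))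
    (↭-trans (↭.++-assoc S T _) (↭-trans (↭.++⁺ˡ S (↭.shifts T F)) (↭-sym (↭.++-assoc S F _))))
...   | w , u⊑w , w⊑ , eq = w , u⊑w , w⊑y , size , λ e → ne (trans (sym (parity-symmetric (suc k) sym-g eq′)) e)
  where
  F = take (t ∸ suc k) R
  eq′ : select w xs ↭ S ++ (F ++ select u xs)
  eq′ = ↭-trans eq (↭.++-assoc S F _)
  w⊑y : w ⊑ y
  w⊑y .at i wi with w⊑ i wi
  ... | inj₁ ui = at u⊑y i ui
  ... | inj₂ Di = proj₁ (∖-lookup y u i Di)
  R≡ : ∣ y ∖ u ∣ ≡ (suc k + suc k) + length R
  R≡ = trans (sym (length-select (y ∖ u) xs)) (trans (↭.↭-length q)
    (trans (List.length-++ (entries (p ∷ ps))) (cong (_+ length R) (length-entries (p ∷ ps)))))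
  F≡ : length F ≡ t ∸ suc k
  F≡ = trans (List.length-take (t ∸ suc k) R) (ℕ.m≤n⇒m⊓n≡m (ℕ.m≤n+o⇒m∸n≤o t (suc k)
    (ℕ.+-cancelʳ-≤ (suc k) t _ (ℕ.≤-trans t+k≤ (ℕ.≤-reflexive (trans R≡
      (trans (ℕ.+-assoc (suc k) (suc k) (length R)) (ℕ.+-comm (suc k) _))))))))
  size : ∣ w ∣ ≡ ∣ u ∣ + t
  size = trans (sym (length-select w xs)) (trans (↭.↭-length eq) (trans (List.length-++ (S ++ F))
    (trans (cong₂ _+_ (trans (List.length-++ S) (trans (cong₂ _+_ (transversal-length tr) F≡) (ℕ.m+[n∸m]≡n k<t)))
      (length-select u xs)) (ℕ.+-comm t _))))

module Colouring (h n g : ℕ) (6≤g : 6 ≤ g) (large : 2 ^ 4 * suc (2 ^ 4 * (h + 4)) ≤ g)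
  (xs : Vec (Code (length (codes h))) n) (xs⊆ : Vec.toList xs ⊆ codes (length (codes h))) where

  -- Numbers the coordinates in binary. The number of coordinates is written `length (codes h)` and
  -- not `2 ^ h` so that `Vec.fromList` fits without a cast.
  ℓs : Vec (Code h) (length (codes h))
  ℓs = Vec.fromList (codes h)

  p₁ p₂ : Subset n → Bool
  p₁ A = parity 4 balanced (select A xs)
  p₂ A = parity 5 (balanced-branchings ℓs) (select A xs)

  instance
    g≢0 : NonZero g
    g≢0 = >-nonZero (ℕ.≤-trans (s≤s z≤n) 6≤g)

  bit : Bool → Fin 2
  bit false = zero
  bit true  = suc zero

  unbit : Fin 2 → Bool
  unbit zero    = false
  unbit (suc _) = true

  unbit-bit : ∀ b → unbit (bit b) ≡ b
  unbit-bit false = refl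
  unbit-bit true  = refl

  colour : Subset n → Fin (g * (2 * 2))
  colour A = Fin.combine (Fin.fromℕ< (ℕ.m%n<n ∣ A ∣ g)) (Fin.combine (bit (p₁ A)) (bit (p₂ A)))

  residue : Fin (g * (2 * 2)) → ℕ
  residue i = toℕ (proj₁ (Fin.remQuot {g} (2 * 2) i))

  bits : Fin (g * (2 * 2)) → Bool × Bool
  bits i = let j , k = Fin.remQuot {2} 2 (proj₂ (Fin.remQuot {g} (2 * 2) i)) in unbit j , unbit k

  residue-colour : ∀ A → residue (colour A) ≡ ∣ A ∣ % g
  residue-colour A = trans (cong (toℕ ∘ proj₁) (Fin.remQuot-combine (Fin.fromℕ< (ℕ.m%n<n ∣ A ∣ g)) _))
    (Fin.toℕ-fromℕ< (ℕ.m%n<n ∣ A ∣ g))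

  bits-colour : ∀ A → bits (colour A) ≡ (p₁ A , p₂ A)
  bits-colour A = trans (cong (λ i → let j , k = Fin.remQuot {2} 2 (proj₂ i) in unbit j , unbit k)
      (Fin.remQuot-combine (Fin.fromℕ< (ℕ.m%n<n ∣ A ∣ g)) _))
    (trans (cong (λ (j , k) → unbit j , unbit k) (Fin.remQuot-combine (bit (p₁ A)) (bit (p₂ A))))
      (cong₂ _,_ (unbit-bit (p₁ A)) (unbit-bit (p₂ A))))

  crossing : ∀ i a {w y : Subset n} → w ⊑ y → a ≤ ∣ w ∣ → ∣ w ∣ ≤ suc a → ∣ y ∣ ≡ a + 2 * g →
             ∃[ x ] w ⊑ x × x ⊑ y × ∣ x ∣ ≡ a + g × colour x ≢ i
  crossing i a {w} {y} w⊑y a≤w w≤1+a y≡ = go (config ℓs ℓs⊆ (⊆-trans (select-⊆ (y ∖ w) xs) xs⊆) many)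
    where
    ℓs⊆ : Vec.toList ℓs ⊆ codes h
    ℓs⊆ = subst (_⊆ codes h) (sym (toList∘fromList (codes h))) ⊆-refl
    t = a + g ∸ ∣ w ∣
    w≤a+g : ∣ w ∣ ≤ a + g
    w≤a+g = ℕ.≤-trans w≤1+a (ℕ.≤-trans (ℕ.≤-reflexive (ℕ.+-comm 1 a)) (ℕ.+-monoʳ-≤ a (ℕ.≤-trans (s≤s z≤n) 6≤g)))
    w+t : ∣ w ∣ + t ≡ a + g
    w+t = ℕ.m+[n∸m]≡n w≤a+g
    D≡ : ∣ y ∖ w ∣ ≡ t + g
    D≡ = ℕ.+-cancelˡ-≡ ∣ w ∣ _ _ (trans (∣∖∣ w⊑y) (trans y≡ (trans
      (cong (λ z → a + (g + z)) (ℕ.+-identityʳ g))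
      (trans (sym (ℕ.+-assoc a g g)) (trans (cong (_+ g) (sym w+t)) (ℕ.+-assoc ∣ w ∣ t g))))))
    -- As `w` lies on the layer `a` or `a + 1`, `t` is at least `g ∸ 1`; this is where `6 ≤ g` comes
    -- from.
    5≤t : 5 ≤ t
    5≤t = ℕ.+-cancelˡ-≤ ∣ w ∣ 5 t (ℕ.≤-trans (ℕ.+-monoˡ-≤ 5 w≤1+a) (ℕ.≤-trans
      (ℕ.≤-trans (ℕ.≤-reflexive (sym (ℕ.+-suc a 5))) (ℕ.+-monoʳ-≤ a 6≤g)) (ℕ.≤-reflexive (sym w+t))))
    many : 2 ^ 4 * suc (2 ^ 4 * (h + 4)) ≤ length (select (y ∖ w) xs)
    many = ℕ.≤-trans large (ℕ.≤-trans (ℕ.m≤n+m g t) (ℕ.≤-reflexive (sym (trans (length-select (y ∖ w) xs) D≡))))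
    fits : ∀ {k} → k ≤ 5 → t + k ≤ ∣ y ∖ w ∣
    fits k≤5 = ℕ.≤-trans (ℕ.+-monoʳ-≤ t (ℕ.≤-trans k≤5 (ℕ.<⇒≤ 6≤g))) (ℕ.≤-reflexive (sym D≡))
    4≤5 : 4 ≤ 5
    4≤5 = ℕ.n≤1+n 4
    go : _ ⊎ _ → _
    go (inj₁ C) with config-crossing xs balanced-↭ w⊑y C t (ℕ.≤-trans 4≤5 5≤t) (fits 4≤5) (proj₁ (bits i))
    ... | x , w⊑x , x⊑y , e , ne = x , w⊑x , x⊑y , trans e w+t ,
          λ c → ne (trans (cong proj₁ (sym (bits-colour x))) (cong (proj₁ ∘ bits) c))
    go (inj₂ C) with config-crossing xs (balanced-branchings-↭ ℓs) w⊑y C t 5≤t (fits ℕ.≤-refl) (proj₂ (bits i))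
    ... | x , w⊑x , x⊑y , e , ne = x , w⊑x , x⊑y , trans e w+t ,
          λ c → ne (trans (cong proj₂ (sym (bits-colour x))) (cong (proj₂ ∘ bits) c))

  colourable : MutualVisibilityColourable (Q n) (g * (2 * 2))
  colourable = colour , λ i → Sparse.mutually-visible (λ A → colour A ≡ i) g
    (ℕ.≤-trans (s≤s (s≤s (s≤s z≤n))) 6≤g) (residue i)
    (λ {x} e → trans (sym (residue-colour x)) (cong residue e)) (crossing i)

initial : ∀ (xs : List X) n → n ≤ length xs → ∃[ v ] Vec.toList {n = n} v ⊆ xs
initial xs       zero    _       = [] , ⊆.[]⊆-universal xs
initial (x ∷ xs) (suc n) (s≤s p) = let v , q = initial xs n p in x ∷ v , refl ∷ q

length-codes : ∀ d → length (codes d) ≡ 2 ^ d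
length-codes zero    = refl
length-codes (suc d) = trans (length-joined (codes d) (codes d))
  (cong₂ _+_ (length-codes d) (trans (length-codes d) (sym (ℕ.+-identityʳ _))))

χμ-bound : ∀ h n → n ≤ 2 ^ (2 ^ h) → χμ (Q n) ≤ 2 ^ 4 * suc (2 ^ 4 * (h + 4)) * 4
χμ-bound h n n≤ = proj₂ (χμ-isLeast (Q n)) _ (go (initial (codes (length (codes h))) n
  (ℕ.≤-trans n≤ (ℕ.≤-reflexive (sym (trans (length-codes (length (codes h))) (cong (2 ^_) (length-codes h))))))))
  where
  go : _ → _
  go (xs , xs⊆) = Colouring.colourable h n _ (ℕ.≤-trans (ℕ.m≤m+n 6 10) (ℕ.m≤m*n 16 _)) ℕ.≤-refl xs xs⊆

-- Logarithms

^-cancelˡ-< : ∀ k {m n} → m ^ k < n ^ k → m < n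
^-cancelˡ-< k {m} {n} p = ℕ.≰⇒> λ n≤m → ℕ.<⇒≱ p (ℕ.^-monoˡ-≤ k n≤m)

*-^ : ∀ a b k → a ^ k * b ^ k ≡ (a * b) ^ k
*-^ a b zero    = refl
*-^ a b (suc k) = trans (interchange ℕ.*-commutativeSemigroup a (a ^ k) b (b ^ k)) (cong (a * b *_) (*-^ a b k))

-- From `k / C ≤ e`, every `p / q` below `2 ^ (k / C)` is below `2 ^ e`; then every `p′ / q′` below
-- `2 ^ (p / q)` is below `2 ^ (2 ^ e)`, hence at most `n`. Both passages are instances of `step`.
≤C·log₂log₂ : ∀ C {n e k} → 2 ^ (2 ^ e) ≤ n → k * ℚ.↧ₙ C ≤ e * ℤ.∣ ℚ.↥ C ∣ →
               k ≤ C · log₂ (log₂ (fromℕ n))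
≤C·log₂log₂ C {n} {e} {k} n≥ k≤ p q p<q p′ q′ p′<q′ =
  ℕ.≤-trans (ℕ.<⇒≤ (step (2 ^ e) p q p<2^e*q p′ q′ p′<q′)) (ℕ.*-monoˡ-≤ q′ n≥)
  where
  step : ∀ e a b → a ≤ e * b → ∀ p q → p ^ b < 2 ^ a * q ^ b → p < 2 ^ e * q
  step e a b a≤ p q l = ^-cancelˡ-< b (ℕ.<-≤-trans l (ℕ.≤-trans
    (ℕ.*-monoˡ-≤ (q ^ b) (ℕ.≤-trans (ℕ.^-monoʳ-≤ 2 a≤) (ℕ.≤-reflexive (sym (ℕ.^-*-assoc 2 e b)))))
    (ℕ.≤-reflexive (*-^ (2 ^ e) q b))))
  p<2^e*q : p ≤ 2 ^ e * q
  p<2^e*q = ℕ.<⇒≤ (step e (k * ℚ.↧ₙ C) ℤ.∣ ℚ.↥ C ∣ k≤ p q p<q)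

loglog : ∀ n → 4 ≤ n → ∃[ e ] 1 ≤ e × 2 ^ (2 ^ e) ≤ n × n ≤ 2 ^ (2 ^ suc e)
-- The search starts at `e = 1`, where `2 ^ (2 ^ e)` is `4`, and needs at most `n` increments since
-- `n ≤ 2 ^ (2 ^ (1 + n))`.
loglog n 4≤n = go n 1 ℕ.≤-refl 4≤n (ℕ.≤-trans (small n)
  (ℕ.≤-trans (small (2 ^ n)) (ℕ.^-monoʳ-≤ 2 (ℕ.^-monoʳ-≤ 2 (ℕ.m≤n+m n 1)))))
  where
  small : ∀ n → n ≤ 2 ^ n
  small zero    = z≤n
  small (suc n) = ℕ.≤-trans (ℕ.+-mono-≤ (ℕ.m^n>0 2 n) (small n))
    (ℕ.+-monoʳ-≤ (2 ^ n) (ℕ.≤-reflexive (sym (ℕ.+-identityʳ _))))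
  go : ∀ d e → 1 ≤ e → 2 ^ (2 ^ e) ≤ n → n ≤ 2 ^ (2 ^ (e + d)) →
       ∃[ e ] 1 ≤ e × 2 ^ (2 ^ e) ≤ n × n ≤ 2 ^ (2 ^ suc e)
  go zero    e 1≤e p q = e , 1≤e , p ,
    ℕ.≤-trans q (ℕ.^-monoʳ-≤ 2 (ℕ.^-monoʳ-≤ 2 (ℕ.≤-trans (ℕ.≤-reflexive (ℕ.+-identityʳ e)) (ℕ.n≤1+n e))))
  go (suc d) e 1≤e p q with n ℕ.≤? 2 ^ (2 ^ suc e)
  ... | yes r = e , 1≤e , p , r
  ... | no ¬r = go d (suc e) (s≤s z≤n) (ℕ.<⇒≤ (ℕ.≰⇒> ¬r)) (subst (λ z → n ≤ 2 ^ (2 ^ z)) (ℕ.+-suc e d) q)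

-- For `e ≥ 1` one has `e + 5 ≤ 6 * e` and `1 + 16 * (6 * e) ≤ 97 * e`; the constant is
-- `16 * 97 * 4`.
linear : ∀ e → 1 ≤ e → 2 ^ 4 * suc (2 ^ 4 * (suc e + 4)) * 4 ≤ e * 6208
linear e 1≤e = ℕ.≤-trans
  (ℕ.*-monoˡ-≤ 4 (ℕ.*-monoʳ-≤ 16 (ℕ.+-mono-≤ 1≤e
    (ℕ.≤-trans (ℕ.*-monoʳ-≤ 16 e+5≤6e) (ℕ.≤-reflexive (sym (ℕ.*-assoc 16 6 e)))))))
  (ℕ.≤-reflexive (regroup 16 97 4 e))
  where
  e+5≤6e : suc e + 4 ≤ 6 * e
  e+5≤6e = ℕ.≤-trans (ℕ.≤-reflexive (sym (ℕ.+-suc e 4))) (ℕ.+-monoʳ-≤ e (ℕ.*-monoʳ-≤ 5 1≤e))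
  regroup : ∀ a b c e → a * (b * e) * c ≡ e * (a * b * c)
  regroup a b c e = trans (cong (_* c) (trans (sym (ℕ.*-assoc a b e)) (ℕ.*-comm (a * b) e)))
    (ℕ.*-assoc e (a * b) c)

constant : ℚ
constant = mkℚ (ℤ.+ 6208) 0 (Coprime.sym (1-coprimeTo 6208))

upper-bound : ∀ n → 4 ≤ n → χμ (Q n) ≤ constant · log₂ (log₂ (fromℕ n))
upper-bound n 4≤n =
  let e , 1≤e , p , q = loglog n 4≤n in
  ≤C·log₂log₂ constant {n} {e} {χμ (Q n)} p (ℕ.≤-trans (ℕ.≤-reflexive (ℕ.*-identityʳ (χμ (Q n))))
    (ℕ.≤-trans (χμ-bound (suc e) n q) (linear e 1≤e)))

theorem2 : (∀ (q : ℕ) → 1 ≤ q → ∃[ n₀ ] ∀ (n : ℕ) → n₀ ≤ n → q < χμ (Q n))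
    × (∃[ C ] (0ℚ ℚ.< C) × (∃[ n₁ ] ∀ (n : ℕ) → n₁ ≤ n → χμ (Q n) ≤ C · log₂ (log₂ (fromℕ n))))
theorem2 = (λ q _ → lower-bound q) , constant , ℚ.positive⁻¹ constant , 4 , upper-bound
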